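{- Let $m\ge 1$ and let $\mathfrak{S}^{(m)}$ be the set of all permutations (of all lengths $n\ge 0$) having no ascending subsequence of length $m+1$. Then, as formal power series in $t$, $$\sum_{\tau\in\mathfrak{S}^{(m)}}\frac{t^{2|\tau|}}{|\tau|!^2}=\det\left(I_{i-j}\right)_{1\le i,j\le m},$$ where for $i\in\mathbb{Z}$ $$I_i=\sum_{n\ge\max(0,-i)}\frac{t^{2n+i}}{n!\,(n+i)!}.$$
   Context: For a permutation $\tau=\tau(1)\cdots\tau(n)$ of $\{1,\dots,n\}$, $|\tau|=n$ denotes its length; the empty permutation (length $0$) is included. An ascending subsequence of $\tau$ of length $k$ is a $k$-tuple $(\tau(i_1),\dots,\tau(i_k))$ with $i_1<\cdots<i_k$ and $\tau(i_1)<\cdots<\tau(i_k)$. -}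

module Defs where

open import Algebra.Bundles.Raw using (RawRing)
import Algebra.Definitions.RawMonoid as RawMonoidDefs
import Algebra.Definitions.RawSemiring as RawSemiringDefs
open import Data.Bool.Base using (if_then_else_)
open import Data.Fin.Base as Fin using (Fin; toℕ; punchIn)
import Data.Fin.Properties as Fin
open import Data.Integer.Base as ℤ using (ℤ; +_; -[1+_])
open import Data.List.Base using (List; []; _∷_; [_]; map; foldr; filter; allFin; cartesianProductWith)
open import Data.List.Membership.Propositional using (_∈_; find; lose)
open import Data.List.Membership.Propositional.Properties using (∈-cartesianProductWith⁺; ∈-allFin)
open import Data.List.Relation.Unary.Any using (here; any?)
open import Data.Nat.Base using (ℕ; zero; suc; _+_; _*_; _∸_; _≤_; _<_; _!)
open import Data.Nat.Properties using (_≟_; _!*_!≢0; m≤m+n; ≤-trans; <⇒≢)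
open import Data.Product.Base using (∃; _×_; _,_; proj₁; proj₂)
open import Data.Rational.Base as ℚ using (ℚ; 0ℚ; 1ℚ)
import Data.Rational.Properties as ℚ
open import Data.Vec.Base using (Vec; []; _∷_; lookup; tabulate)
open import Data.Vec.Properties using (lookup∘tabulate)
open import Function.Base using (_∘_)
open import Function.Definitions using (Injective; Surjective; Bijective)
open import Level using (0ℓ)
open import Relation.Binary.Core using (_Preserves_⟶_)
open import Relation.Binary.PropositionalEquality using (_≡_; refl; sym; trans; cong; cong₂; subst₂)
open import Relation.Nullary.Decidable using (Dec; does; dec-false; map′; _×-dec_; _→-dec_; ¬?)
open import Relation.Nullary.Negation using (¬_)

IsPermutation : ∀ {n} → Vec (Fin n) n → Set
IsPermutation τ = Bijective _≡_ _≡_ (lookup τ)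

-- i is the tuple of positions i₁ < ⋯ < i_k.
IsAscending : ∀ {n k} → Vec (Fin n) n → (Fin k → Fin n) → Set
IsAscending τ i = i Preserves Fin._<_ ⟶ Fin._<_
                × (lookup τ ∘ i) Preserves Fin._<_ ⟶ Fin._<_

HasAscending : ∀ {n} → ℕ → Vec (Fin n) n → Set
HasAscending {n} k τ = ∃ λ (i : Fin k → Fin n) → IsAscending τ i

In𝔖 : ∀ {n} → ℕ → Vec (Fin n) n → Set
In𝔖 m τ = IsPermutation τ × ¬ HasAscending (suc m) τ

words : ∀ n k → List (Vec (Fin n) k)
words n zero    = [ [] ]
words n (suc k) = cartesianProductWith _∷_ (allFin n) (words n k)

∈-words : ∀ {n k} (w : Vec (Fin n) k) → w ∈ words n k
∈-words []      = here refl
∈-words (x ∷ w) = ∈-cartesianProductWith⁺ _∷_ (∈-allFin x) (∈-words w)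

isPermutation? : ∀ {n} (τ : Vec (Fin n) n) → Dec (IsPermutation τ)
isPermutation? τ = injective? ×-dec surjective?
  where
  injective? : Dec (Injective _≡_ _≡_ (lookup τ))
  injective? = map′ (λ f {x} {y} → f x y) (λ f x y → f {x} {y})
    (Fin.all? λ x → Fin.all? λ y → (lookup τ x Fin.≟ lookup τ y) →-dec (x Fin.≟ y))

  surjective? : Dec (Surjective _≡_ _≡_ (lookup τ))
  surjective? = map′
    (λ f y → proj₁ (f y) , λ { refl → proj₂ (f y) })
    (λ f y → proj₁ (f y) , proj₂ (f y) refl)
    (Fin.all? λ y → Fin.any? λ x → lookup τ x Fin.≟ y)

monotone? : ∀ {k n} (f : Fin k → Fin n) → Dec (f Preserves Fin._<_ ⟶ Fin._<_)
monotone? f = map′ (λ g {x} {y} → g x y) (λ g x y → g {x} {y})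
  (Fin.all? λ x → Fin.all? λ y → (x Fin.<? y) →-dec (f x Fin.<? f y))

hasAscending? : ∀ {n} k (τ : Vec (Fin n) n) → Dec (HasAscending k τ)
hasAscending? {n} k τ = map′ to from
  (any? (λ w → monotone? (lookup w) ×-dec monotone? (lookup τ ∘ lookup w)) (words n k))
  where
  to   = λ p → let w , _ , asc = find p in lookup w , asc
  from = λ { (i , up , asc) → lose (∈-words (tabulate i))
    ( (λ {x} {y} x<y → subst₂ Fin._<_ (sym (lookup∘tabulate i x)) (sym (lookup∘tabulate i y)) (up x<y))
    , (λ {x} {y} x<y → subst₂ (λ a b → lookup τ a Fin.< lookup τ b)
        (sym (lookup∘tabulate i x)) (sym (lookup∘tabulate i y)) (asc x<y))) }

in𝔖? : ∀ {n} m (τ : Vec (Fin n) n) → Dec (In𝔖 m τ)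
in𝔖? m τ = isPermutation? τ ×-dec ¬? (hasAscending? (suc m) τ)

-- Each word occurs exactly once in  words n n,  so this lists, without
-- repetition, the elements of 𝔖⁽ᵐ⁾ of length n.
𝔖 : ∀ m n → List (Vec (Fin n) n)
𝔖 m n = filter (in𝔖? m) (words n n)

-- Formal power series in t over ℚ;  f k  is the coefficient of t^k.
Series : Set
Series = ℕ → ℚ

∑ : ∀ {n} → (Fin n → ℚ) → ℚ
∑ = RawMonoidDefs.sum ℚ.+-0-rawMonoid

monomial : ℚ → ℕ → Series
monomial c e k = if does (k ≟ e) then c else 0ℚ

seriesRing : RawRing 0ℓ 0ℓ
seriesRing = record
  { Carrier = Series
  ; _≈_     = λ f g → ∀ k → f k ≡ g k
  ; _+_     = λ f g k → f k ℚ.+ g k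
  ; _*_     = λ f g k → ∑ {suc k} λ i → f (toℕ i) ℚ.* g (k ∸ toℕ i)
  ; -_      = λ f k → ℚ.- f k
  ; 0#      = λ _ → 0ℚ
  ; 1#      = monomial 1ℚ 0
  }

open RawRing seriesRing public using () renaming (_≈_ to infix 4 _≈ₛ_; _+_ to _+ₛ_; 0# to 0ₛ)

sumₛ : List Series → Series
sumₛ = foldr _+ₛ_ 0ₛ

OrderAtLeastIndex : (ℕ → Series) → Set
OrderAtLeastIndex f = ∀ n k → k < n → f n k ≡ 0ℚ

-- Infinite sum  ∑_{n ≥ 0} f n.  As  t^n  divides  f n,  the terms with n > k
-- do not contribute to the coefficient of t^k.
∑∞ : (f : ℕ → Series) → .(OrderAtLeastIndex f) → Series
∑∞ f _ k = ∑ {suc k} λ n → f (toℕ n) k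

monomial-order : ∀ c e {n} k → n ≤ e → k < n → monomial c e k ≡ 0ℚ
monomial-order c e k n≤e k<n =
  cong (if_then c else 0ℚ) (dec-false (k ≟ e) (<⇒≢ (≤-trans k<n n≤e)))

module Determinant {c ℓ} (R : RawRing c ℓ) where
  open RawRing R using (Carrier; 1#; -_; rawSemiring; +-rawMonoid) renaming (_*_ to _·_)
  open RawSemiringDefs rawSemiring using (_^_)
  open RawMonoidDefs +-rawMonoid using (sum)

  -- Laplace expansion along the first row.
  det : ∀ n → (Fin n → Fin n → Carrier) → Carrier
  det zero    M = 1#
  det (suc n) M = sum λ j →
    ((- 1#) ^ toℕ j) · (M Fin.zero j · det n (λ r s → M (Fin.suc r) (punchIn j s)))

open Determinant seriesRing public using (det)

1/[_!*_!] : ℕ → ℕ → ℚ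
1/[ a !* b !] = ℚ._/_ (+ 1) (a ! * b !) ⦃ a !* b !≢0 ⦄

permTerm : ∀ {n} → Vec (Fin n) n → Series
permTerm {n} τ = monomial 1/[ n !* n !] (2 * n)

lhsTerm : ℕ → ℕ → Series
lhsTerm m n = sumₛ (map permTerm (𝔖 m n))

lhsTerm-order : ∀ m → OrderAtLeastIndex (lhsTerm m)
lhsTerm-order m n k k<n = go (𝔖 m n)
  where
  go : ∀ τs → sumₛ (map permTerm τs) k ≡ 0ℚ
  go []       = refl
  go (τ ∷ τs) = trans
    (cong₂ ℚ._+_ (monomial-order 1/[ n !* n !] (2 * n) k (m≤m+n n _) k<n) (go τs))
    (ℚ.+-identityˡ 0ℚ)

lhs : ℕ → Series
lhs m = ∑∞ (lhsTerm m) (lhsTerm-order m)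

-- Applied to n and n + i.  When n + i = p ≥ 0, the exponent 2n + i is n + p;
-- n + i < 0 is the excluded range n < -i.
besselSummand : ℕ → ℤ → Series
besselSummand n (+ p)    = monomial 1/[ n !* p !] (n + p)
besselSummand n -[1+ _ ] = 0ₛ

besselTerm : ℤ → ℕ → Series
besselTerm i n = besselSummand n (+ n ℤ.+ i)

besselTerm-order : ∀ i → OrderAtLeastIndex (besselTerm i)
besselTerm-order i n k k<n with + n ℤ.+ i
... | + p      = monomial-order 1/[ n !* p !] (n + p) k (m≤m+n n p) k<n
... | -[1+ _ ] = refl

I : ℤ → Series
I i = ∑∞ (besselTerm i) (besselTerm-order i)

{-# OPTIONS --safe #-}
-- Read a permutation from left to right and record for each unused value u the
-- maximal length c(u) of an ascending subsequence, of the prefix read so far,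
-- whose values lie below u.  Using a value v is allowed iff c(v) < m, and then
-- replaces c(u) by max(c(u), c(v) + 1) for the unused u > v.  As c is weakly
-- increasing in u, only the entries c(u) = c(v) change.
--
-- The number of ways to complete a prefix with k unused values is
--   k! Σ_f det (1/(y_s(f) - r)!),   1 ≤ r, s ≤ m,
-- where f assigns to each unused u a block f(u) in {c(u), ..., m - 1} and
-- y_s(f) = s + (size of block s - 1).  Indeed, if α(y) is the determinant, then
-- Σ_s α(y - e_s) = (Σ_s y_s - Σ_r r) α(y).  So k times the sum over f equals the
-- same sum with α(y) replaced by Σ_s α(y - e_s); the term of s counts the
-- choices of f together with the last v with c(v) = s - 1 = f(v), except for the
-- f without such a v, and these cancel because α is antisymmetric.
--
-- For the empty prefix the sum ranges over all f : {1, ..., n} → blocks.  Its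
-- exponential generating function is obtained by expanding the determinant
-- entrywise: the size of block s enters column s only, so entry (r, s) becomes
-- Σ_a t^a / (a! (a + s - r)!), which is I_{r-s} up to t^a ↦ t^(2a) and a factor
-- t^(s-r) that cancels in the determinant.
module Submission where

open import Defs
open import Algebra.Bundles.Raw using (RawRing)
open import Algebra.Definitions.RawMonoid (RawRing.+-rawMonoid seriesRing) using () renaming (sum to sumS)
open import Algebra.Definitions.RawSemiring (RawRing.rawSemiring seriesRing) using (_^_)
open import Data.Bool.Base as Bool using (Bool; if_then_else_; true; false)
open import Data.Fin.Base as Fin using (Fin; zero; suc; toℕ; punchIn; punchOut)
import Data.Fin.Properties as Fin
open import Data.Integer.Base as ℤ using (-[1+_])
import Data.Integer.Properties as ℤ
open import Data.List.Base as List using (List; []; _∷_; length; _++_; allFin; tabulate; cartesianProductWith; filter)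
open import Data.List.Properties using (tabulate-cong)
open import Data.List.Relation.Unary.All using (All; []; _∷_)
open import Data.Maybe.Base as Maybe using (Maybe; just; nothing; maybe′)
import Data.Maybe.Relation.Unary.All as MaybeAll
open import Data.Nat.Base as ℕ using (ℕ; zero; suc; pred; _≤_; _<_; z≤n; s≤s; _!; NonZero; _⊔_; _∸_)
open import Data.Nat.ListAction using (sum)
import Data.Nat.Properties as ℕ
open import Algebra.Properties.CommutativeSemigroup ℕ.+-commutativeSemigroup using (x∙yz≈y∙xz)
open import Data.Product.Base using (∃; _×_; _,_; proj₁; proj₂; curry; uncurry)
open import Data.Rational.Base as ℚ using (ℚ; 0ℚ; 1ℚ; _+_; _*_; -_)
import Data.Rational.Properties as ℚ
open import Algebra.Properties.Ring ℚ.+-*-ring using (-1*x≈-x)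
open import Data.Rational.Solver using (module +-*-Solver)
open +-*-Solver using (solve; con; _:+_; _:*_; :-_; _:=_)
import Data.Rational.Unnormalised.Base as ℚᵘ
import Data.Rational.Unnormalised.Properties as ℚᵘ
open import Data.Sum.Base using (inj₁; inj₂)
open import Data.Vec.Base as Vec using (Vec; []; _∷_; lookup; replicate)
open import Data.Vec.Properties using (lookup-map; lookup-replicate)
open import Data.Vec.Relation.Unary.All as VecAll using ([]; _∷_)
open import Function.Base using (_∘_; id)
open import Function.Definitions using (Injective; Surjective)
open import Relation.Binary.Core using (_Preserves_⟶_)
open import Relation.Binary.Definitions using (tri<; tri≈; tri>)
open import Relation.Binary.PropositionalEquality
open import Relation.Nullary.Decidable using (Dec; does; yes; no; dec-true; dec-false)
open import Relation.Nullary.Negation using (contradiction)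
open ≡-Reasoning
open RawRing seriesRing using (1#) renaming (_*_ to _⊛_; -_ to -ₛ_)

-- Linear functionals on rational-valued functions.

-- Finite sums, alternating sums and the coefficients of products and shifts are all instances.
-- `≗-cong` is a field of its own because pointwise equality of functions does not yield `_≡_` here.
record Linear {X : Set} (L : (X → ℚ) → ℚ) : Set where
  field
    ≗-cong : ∀ {f g} → f ≗ g → L f ≡ L g
    +-homo : ∀ f g → L (λ x → f x + g x) ≡ L f + L g
    *-homo : ∀ c f → L (λ x → c * f x) ≡ c * L f

  -‿homo : ∀ f → L (λ x → - f x) ≡ - L f
  -‿homo f = begin
    L (λ x → - f x)       ≡⟨ ≗-cong (λ x → -1*x≈-x (f x)) ⟨
    L (λ x → - 1ℚ * f x)  ≡⟨ *-homo (- 1ℚ) f ⟩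
    - 1ℚ * L f            ≡⟨ -1*x≈-x (L f) ⟩
    - L f                 ∎

  0-homo : L (λ _ → 0ℚ) ≡ 0ℚ
  0-homo = trans (*-homo 0ℚ (λ _ → 0ℚ)) (ℚ.*-zeroˡ (L (λ _ → 0ℚ)))

open Linear

interchange : ∀ a b c d → (a + b) + (c + d) ≡ (a + c) + (b + d)
interchange = solve 4 (λ a b c d → (a :+ b) :+ (c :+ d) := (a :+ c) :+ (b :+ d)) refl

module _ {X : Set} where

  evaluation : (x : X) → Linear (λ f → f x)
  evaluation x = record
    { ≗-cong = λ f≗g → f≗g x
    ; +-homo = λ f g → refl
    ; *-homo = λ c f → refl
    }

  zero-linear : Linear {X} (λ f → 0ℚ)
  zero-linear = record
    { ≗-cong = λ f≗g → refl
    ; +-homo = λ f g → refl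
    ; *-homo = λ c f → sym (ℚ.*-zeroʳ c)
    }

  module _ {L M : (X → ℚ) → ℚ} (l : Linear L) (m : Linear M) where

    +-linear : Linear (λ f → L f + M f)
    +-linear = record
      { ≗-cong = λ f≗g → cong₂ _+_ (≗-cong l f≗g) (≗-cong m f≗g)
      ; +-homo = λ f g → trans (cong₂ _+_ (+-homo l f g) (+-homo m f g))
                               (interchange (L f) (L g) (M f) (M g))
      ; *-homo = λ c f → trans (cong₂ _+_ (*-homo l c f) (*-homo m c f))
                               (sym (ℚ.*-distribˡ-+ c (L f) (M f)))
      }

  module _ {L : (X → ℚ) → ℚ} (l : Linear L) where

    neg-linear : Linear (λ f → - L f)
    neg-linear = record
      { ≗-cong = λ f≗g → cong -_ (≗-cong l f≗g)
      ; +-homo = λ f g → trans (cong -_ (+-homo l f g)) (ℚ.neg-distrib-+ (L f) (L g))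
      ; *-homo = λ c f → trans (cong -_ (*-homo l c f)) (ℚ.neg-distribʳ-* c (L f))
      }

    scale-linear : ∀ a → Linear (λ f → a * L f)
    scale-linear a = record
      { ≗-cong = λ f≗g → cong (a *_) (≗-cong l f≗g)
      ; +-homo = λ f g → trans (cong (a *_) (+-homo l f g)) (ℚ.*-distribˡ-+ a (L f) (L g))
      ; *-homo = λ c f → trans (cong (a *_) (*-homo l c f))
          (solve 3 (λ a c x → a :* (c :* x) := c :* (a :* x)) refl a c (L f))
      }

    scaleʳ-linear : ∀ a → Linear (λ f → L f * a)
    scaleʳ-linear a = record
      { ≗-cong = λ f≗g → cong (_* a) (≗-cong l f≗g)
      ; +-homo = λ f g → trans (cong (_* a) (+-homo l f g)) (ℚ.*-distribʳ-+ a (L f) (L g))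
      ; *-homo = λ c f → trans (cong (_* a) (*-homo l c f)) (ℚ.*-assoc c (L f) a)
      }

    compose-linear : ∀ {Y : Set} {M : X → (Y → ℚ) → ℚ} → (∀ x → Linear (M x)) → Linear (λ f → L (λ x → M x f))
    compose-linear {M = M} m = record
      { ≗-cong = λ f≗g → ≗-cong l (λ x → ≗-cong (m x) f≗g)
      ; +-homo = λ f g → trans (≗-cong l (λ x → +-homo (m x) f g)) (+-homo l (λ x → M x f) (λ x → M x g))
      ; *-homo = λ c f → trans (≗-cong l (λ x → *-homo (m x) c f)) (*-homo l c (λ x → M x f))
      }

    pullback-linear : ∀ {Y : Set} (φ : X → Y) → Linear (λ f → L (f ∘ φ))
    pullback-linear φ = record
      { ≗-cong = λ f≗g → ≗-cong l (f≗g ∘ φ)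
      ; +-homo = λ f g → +-homo l (f ∘ φ) (g ∘ φ)
      ; *-homo = λ c f → *-homo l c (f ∘ φ)
      }

-- The embedding of ℕ; alternating sums and derivations on lists.

ι : ℕ → ℚ
ι zero    = 0ℚ
ι (suc n) = 1ℚ + ι n

ι-+ : ∀ m n → ι (m ℕ.+ n) ≡ ι m + ι n
ι-+ zero    n = sym (ℚ.+-identityˡ (ι n))
ι-+ (suc m) n = trans (cong (1ℚ +_) (ι-+ m n)) (sym (ℚ.+-assoc 1ℚ (ι m) (ι n)))

-- Σⱼ (-1)ʲ F (xⱼ , xs without xⱼ), as in a Laplace expansion.
altSum : List ℕ → (ℕ → List ℕ → ℚ) → ℚ
altSum []       F = 0ℚ
altSum (x ∷ xs) F = F x xs + - altSum xs (λ y ys → F y (x ∷ ys))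

altSum-linear : ∀ xs → Linear (λ F → altSum xs (curry F))
altSum-linear []       = zero-linear
altSum-linear (x ∷ xs) = +-linear (evaluation (x , xs))
  (neg-linear (pullback-linear (altSum-linear xs) (λ (y , ys) → y , x ∷ ys)))

-- The premise `y + sum ys ≡ sum xs` lets a factor that depends on the total of the list be treated
-- as a constant, as in `factorialDet-pred`.
altSum-cong : ∀ xs {F G} → (∀ y ys → y ℕ.+ sum ys ≡ sum xs → F y ys ≡ G y ys) →
              altSum xs F ≡ altSum xs G
altSum-cong []       eq = refl
altSum-cong (x ∷ xs) eq = cong₂ (λ a b → a + - b) (eq x xs refl)
  (altSum-cong xs λ y ys p → eq y (x ∷ ys)
    (trans (x∙yz≈y∙xz y x (sum ys)) (cong (x ℕ.+_) p)))

-- f summed over the ways to apply φ to one entry of the list.  This is a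
-- derivation with respect to the products inside altSum, see deriv-altSum.
deriv : (ℕ → ℕ) → (List ℕ → ℚ) → List ℕ → ℚ
deriv φ f []       = 0ℚ
deriv φ f (y ∷ ys) = f (φ y ∷ ys) + deriv φ (f ∘ (y ∷_)) ys

deriv-linear : ∀ φ ys → Linear (λ f → deriv φ f ys)
deriv-linear φ []       = zero-linear
deriv-linear φ (y ∷ ys) = +-linear (evaluation (φ y ∷ ys)) (pullback-linear (deriv-linear φ ys) (y ∷_))

deriv-exchange : ∀ {X : Set} {L : (X → ℚ) → ℚ} → Linear L → ∀ φ ys (G : X → List ℕ → ℚ) →
  L (λ x → deriv φ (G x) ys) ≡ deriv φ (λ zs → L (λ x → G x zs)) ys
deriv-exchange l φ []       G = 0-homo l
deriv-exchange {L = L} l φ (y ∷ ys) G = trans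
  (+-homo l (λ x → G x (φ y ∷ ys)) (λ x → deriv φ (G x ∘ (y ∷_)) ys))
  (cong (L (λ x → G x (φ y ∷ ys)) +_) (deriv-exchange l φ ys (λ x → G x ∘ (y ∷_))))

-- The entry to which `φ` is applied is either the removed one or one of the remaining ones.
deriv-altSum : ∀ φ F ys → deriv φ (λ zs → altSum zs F) ys
                        ≡ altSum ys (λ y zs → F (φ y) zs + deriv φ (F y) zs)
deriv-altSum φ F []       = refl
deriv-altSum φ F (y ∷ ys) = begin
  (F (φ y) ys + - A) + deriv φ (λ zs → F y zs + - altSum zs (F′ y)) ys
    ≡⟨ cong ((F (φ y) ys + - A) +_) (begin
         deriv φ (λ zs → F y zs + - altSum zs (F′ y)) ys
           ≡⟨ +-homo D (F y) (λ zs → - altSum zs (F′ y)) ⟩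
         deriv φ (F y) ys + deriv φ (λ zs → - altSum zs (F′ y)) ys
           ≡⟨ cong (deriv φ (F y) ys +_) (-‿homo D (λ zs → altSum zs (F′ y))) ⟩
         deriv φ (F y) ys + - deriv φ (λ zs → altSum zs (F′ y)) ys
           ≡⟨ cong (λ x → deriv φ (F y) ys + - x) (deriv-altSum φ (F′ y) ys) ⟩
         deriv φ (F y) ys + - B ∎) ⟩
  (F (φ y) ys + - A) + (deriv φ (F y) ys + - B)
    ≡⟨ solve 4 (λ u a v b → (u :+ :- a) :+ (v :+ :- b) := (u :+ v) :+ :- (a :+ b)) refl
         (F (φ y) ys) A (deriv φ (F y) ys) B ⟩
  (F (φ y) ys + deriv φ (F y) ys) + - (A + B)
    ≡⟨ cong (λ x → (F (φ y) ys + deriv φ (F y) ys) + - x) (begin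
         A + B ≡⟨ +-homo (altSum-linear ys) (λ (z , zs) → F z (φ y ∷ zs))
                    (λ (z , zs) → F′ y (φ z) zs + deriv φ (F′ y z) zs) ⟨
         altSum ys (λ z zs → F z (φ y ∷ zs) + (F′ y (φ z) zs + deriv φ (F′ y z) zs))
               ≡⟨ altSum-cong ys (λ z zs _ →
                    solve 3 (λ a b c → a :+ (b :+ c) := b :+ (a :+ c)) refl
                      (F z (φ y ∷ zs)) (F′ y (φ z) zs) (deriv φ (F′ y z) zs)) ⟩
         altSum ys (λ z zs → F (φ z) (y ∷ zs) + deriv φ (F z) (y ∷ zs)) ∎) ⟩
  (F (φ y) ys + deriv φ (F y) ys) +
    - altSum ys (λ z zs → F (φ z) (y ∷ zs) + deriv φ (F z) (y ∷ zs)) ∎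
  where
  F′ : ℕ → ℕ → List ℕ → ℚ
  F′ y z zs = F z (y ∷ zs)
  D = deriv-linear φ ys
  A = altSum ys (F′ (φ y))
  B = altSum ys (λ z zs → F′ y (φ z) zs + deriv φ (F′ y z) zs)

-- As deriv suc, restricted to the positions from c on.
incSum : ℕ → List ℕ → (List ℕ → ℚ) → ℚ
incSum zero    ys       f = deriv suc f ys
incSum (suc c) []       f = 0ℚ
incSum (suc c) (y ∷ ys) f = incSum c ys (f ∘ (y ∷_))

incSum-linear : ∀ c ys → Linear (incSum c ys)
incSum-linear zero    ys       = deriv-linear suc ys
incSum-linear (suc c) []       = zero-linear
incSum-linear (suc c) (y ∷ ys) = pullback-linear (incSum-linear c ys) (y ∷_)

incSum-exchange : ∀ {X : Set} {L : (X → ℚ) → ℚ} → Linear L → ∀ c ys (G : X → List ℕ → ℚ) →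
  L (λ x → incSum c ys (G x)) ≡ incSum c ys (λ zs → L (λ x → G x zs))
incSum-exchange l zero    ys       G = deriv-exchange l suc ys G
incSum-exchange l (suc c) []       G = 0-homo l
incSum-exchange l (suc c) (y ∷ ys) G = incSum-exchange l c ys (λ x → G x ∘ (y ∷_))

at : (ℕ → ℕ) → ℕ → List ℕ → List ℕ
at φ j       []       = []
at φ zero    (y ∷ ys) = φ y ∷ ys
at φ (suc j) (y ∷ ys) = y ∷ at φ j ys

deriv-cong : ∀ {φ f g} ys → (∀ j → j < length ys → f (at φ j ys) ≡ g (at φ j ys)) →
             deriv φ f ys ≡ deriv φ g ys
deriv-cong []       eq = refl
deriv-cong (y ∷ ys) eq =
  cong₂ _+_ (eq 0 (s≤s z≤n)) (deriv-cong ys λ j j< → eq (suc j) (s≤s j<))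

incSum-cong : ∀ {f g} c ys → (∀ j → j < length ys → f (at suc j ys) ≡ g (at suc j ys)) →
              incSum c ys f ≡ incSum c ys g
incSum-cong zero    ys       eq = deriv-cong ys eq
incSum-cong (suc c) []       eq = refl
incSum-cong (suc c) (y ∷ ys) eq = incSum-cong c ys λ j j< → eq (suc j) (s≤s j<)

sum-at-suc : ∀ j ys → j < length ys → sum (at suc j ys) ≡ suc (sum ys)
sum-at-suc zero    (y ∷ ys) _        = refl
sum-at-suc (suc j) (y ∷ ys) (s≤s j<) =
  trans (cong (y ℕ.+_) (sum-at-suc j ys j<)) (ℕ.+-suc y (sum ys))

positive-at-suc : ∀ j {ys} → All (1 ≤_) ys → All (1 ≤_) (at suc j ys)
positive-at-suc j       []       = []
positive-at-suc zero    (p ∷ ps) = s≤s z≤n ∷ ps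
positive-at-suc (suc j) (p ∷ ps) = p ∷ positive-at-suc j ps

-- At one and the same entry, `suc (pred y)` and `pred (suc y)` agree only for y ≥ 1, hence the
-- positivity. Changes at different entries commute anyway.
deriv-pred-suc : ∀ {ys} → All (1 ≤_) ys → ∀ f →
  deriv pred (λ zs → deriv suc f zs) ys ≡ deriv suc (deriv pred f) ys
deriv-pred-suc []                    f = refl
deriv-pred-suc {suc y ∷ ys} (_ ∷ ps) f = begin
  (a + b) + deriv pred (λ zs → f (2 ℕ.+ y ∷ zs) + deriv suc f₁ zs) ys
    ≡⟨ cong ((a + b) +_) (+-homo (deriv-linear pred ys) f₂ (deriv suc f₁)) ⟩
  (a + b) + (c + deriv pred (deriv suc f₁) ys)
    ≡⟨ cong (λ x → (a + b) + (c + x)) (deriv-pred-suc ps f₁) ⟩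
  (a + b) + (c + d)
    ≡⟨ interchange a b c d ⟩
  (a + c) + (b + d)
    ≡⟨ cong ((a + c) +_) (+-homo (deriv-linear suc ys) f₀ (deriv pred f₁)) ⟨
  (a + c) + deriv suc (λ zs → f (y ∷ zs) + deriv pred f₁ zs) ys ∎
  where
  f₀ = f ∘ (y ∷_)
  f₁ = f ∘ (suc y ∷_)
  f₂ = f ∘ (2 ℕ.+ y ∷_)
  a = f (suc y ∷ ys)
  b = deriv suc f₀ ys
  c = deriv pred f₂ ys
  d = deriv suc (deriv pred f₁) ys

deriv-pred-incSum : ∀ c {ys} → All (1 ≤_) ys → ∀ f →
  deriv pred (λ zs → incSum c zs f) ys ≡ incSum c ys (deriv pred f)
deriv-pred-incSum zero    ps       f = deriv-pred-suc ps f
deriv-pred-incSum (suc c) []       f = refl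
deriv-pred-incSum (suc c) {y ∷ ys} (p ∷ ps) f = begin
  incSum c ys (f ∘ (pred y ∷_)) + deriv pred (λ zs → incSum c zs (f ∘ (y ∷_))) ys
    ≡⟨ cong (incSum c ys (f ∘ (pred y ∷_)) +_) (deriv-pred-incSum c ps (f ∘ (y ∷_))) ⟩
  incSum c ys (f ∘ (pred y ∷_)) + incSum c ys (deriv pred (f ∘ (y ∷_)))
    ≡⟨ +-homo (incSum-linear c ys) (f ∘ (pred y ∷_)) (deriv pred (f ∘ (y ∷_))) ⟨
  incSum c ys (λ zs → f (pred y ∷ zs) + deriv pred (f ∘ (y ∷_)) zs) ∎

incSum-at : ∀ c j ys g → incSum c (at suc j ys) g ≡ incSum c ys (g ∘ at suc j)
incSum-at zero    j       []       g = refl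
incSum-at (suc c) j       []       g = refl
incSum-at zero    zero    (y ∷ ys) g = refl
incSum-at zero    (suc j) (y ∷ ys) g = cong (g (suc y ∷ at suc j ys) +_) (incSum-at zero j ys (g ∘ (y ∷_)))
incSum-at (suc c) zero    (y ∷ ys) g = refl
incSum-at (suc c) (suc j) (y ∷ ys) g = incSum-at c j ys (g ∘ (y ∷_))

incSum-split : ∀ j ys g → j < length ys → incSum j ys g ≡ g (at suc j ys) + incSum (suc j) ys g
incSum-split zero    (y ∷ ys) g _        = refl
incSum-split (suc j) (y ∷ ys) g (s≤s j<) = incSum-split j ys (g ∘ (y ∷_)) j<

-- Adjacent transpositions and antisymmetry.

data Swap : ℕ → List ℕ → List ℕ → Set where
  here  : ∀ {x y zs}      → Swap 0 (x ∷ y ∷ zs) (y ∷ x ∷ zs)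
  there : ∀ {p x ys ys′} → Swap p ys ys′ → Swap (suc p) (x ∷ ys) (x ∷ ys′)

-- The two terms that remove a transposed entry trade places and, being adjacent, carry opposite
-- signs; every other term changes sign by the hypothesis.
altSum-swap : ∀ {F : ℕ → List ℕ → ℚ} → (∀ y {p zs zs′} → Swap p zs zs′ → F y zs ≡ - F y zs′) →
  ∀ {p ys ys′} → Swap p ys ys′ → altSum ys F ≡ - altSum ys′ F
altSum-swap {F} anti {ys = x ∷ y ∷ zs} here = begin
  F x (y ∷ zs) + - (F y (x ∷ zs) + - altSum zs (λ z us → F z (x ∷ y ∷ us)))
    ≡⟨ cong (λ s → F x (y ∷ zs) + - (F y (x ∷ zs) + - s))
         (trans (altSum-cong zs (λ z us _ → anti z here))
                (-‿homo (altSum-linear zs) (λ (z , us) → F z (y ∷ x ∷ us)))) ⟩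
  F x (y ∷ zs) + - (F y (x ∷ zs) + - - A)
    ≡⟨ solve 3 (λ a b s → a :+ :- (b :+ :- :- s) := :- (b :+ :- (a :+ :- s))) refl
         (F x (y ∷ zs)) (F y (x ∷ zs)) A ⟩
  - (F y (x ∷ zs) + - (F x (y ∷ zs) + - A)) ∎
  where A = altSum zs (λ z us → F z (y ∷ x ∷ us))
altSum-swap {F} anti {ys = x ∷ ys} {x ∷ ys′} (there σ) = trans
  (cong₂ (λ a b → a + - b) (anti x σ) (altSum-swap (λ y τ → anti y (there τ)) σ))
  (sym (ℚ.neg-distrib-+ (F x ys′) (- altSum ys′ (λ y zs → F y (x ∷ zs)))))

-- For `c ≢ suc p` the positions `p` and `suc p` are both allowed or both excluded, so transposing
-- them permutes the summands up to sign.
incSum-swap : ∀ {f : List ℕ → ℚ} {p} → (∀ {zs zs′} → Swap p zs zs′ → f zs ≡ - f zs′) →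
  ∀ c {ys ys′} → c ≢ suc p → Swap p ys ys′ → incSum c ys f ≡ - incSum c ys′ f
incSum-swap {f} anti zero {x ∷ y ∷ zs} c≢ here = begin
  f (suc x ∷ y ∷ zs) + (f (x ∷ suc y ∷ zs) + deriv suc (λ us → f (x ∷ y ∷ us)) zs)
    ≡⟨ cong₂ _+_ (anti here) (cong₂ _+_ (anti here)
         (trans (≗-cong D (λ us → anti here)) (-‿homo D (λ us → f (y ∷ x ∷ us))))) ⟩
  - f (y ∷ suc x ∷ zs) + (- f (suc y ∷ x ∷ zs) + - deriv suc (λ us → f (y ∷ x ∷ us)) zs)
    ≡⟨ solve 3 (λ a b s → :- a :+ (:- b :+ :- s) := :- (b :+ (a :+ s))) refl
         (f (y ∷ suc x ∷ zs)) (f (suc y ∷ x ∷ zs)) (deriv suc (λ us → f (y ∷ x ∷ us)) zs) ⟩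
  - (f (suc y ∷ x ∷ zs) + (f (y ∷ suc x ∷ zs) + deriv suc (λ us → f (y ∷ x ∷ us)) zs)) ∎
  where D = deriv-linear suc zs
incSum-swap anti (suc zero) c≢ here = contradiction refl c≢
incSum-swap {f} anti (suc (suc c)) {x ∷ y ∷ zs} c≢ here =
  trans (≗-cong l (λ us → anti here)) (-‿homo l (λ us → f (y ∷ x ∷ us)))
  where l = incSum-linear c zs
incSum-swap {f} anti zero {x ∷ ys} {x ∷ ys′} c≢ (there σ) = trans
  (cong₂ _+_ (anti (there σ)) (incSum-swap (anti ∘ there) zero (λ ()) σ))
  (sym (ℚ.neg-distrib-+ (f (suc x ∷ ys′)) (deriv suc (f ∘ (x ∷_)) ys′)))
incSum-swap {f} anti (suc c) c≢ (there σ) = incSum-swap (anti ∘ there) c (c≢ ∘ cong suc) σ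

-- Reciprocals and inverse factorials in ℚ.

fromℚᵘ-homo-+ : ∀ p q → ℚ.fromℚᵘ p + ℚ.fromℚᵘ q ≡ ℚ.fromℚᵘ (p ℚᵘ.+ q)
fromℚᵘ-homo-+ p q = ℚ.toℚᵘ-injective
  (ℚᵘ.≃-trans (ℚ.toℚᵘ-homo-+ (ℚ.fromℚᵘ p) (ℚ.fromℚᵘ q))
  (ℚᵘ.≃-trans (ℚᵘ.+-cong (ℚ.toℚᵘ-fromℚᵘ p) (ℚ.toℚᵘ-fromℚᵘ q))
  (ℚᵘ.≃-sym (ℚ.toℚᵘ-fromℚᵘ (p ℚᵘ.+ q)))))

fromℚᵘ-homo-* : ∀ p q → ℚ.fromℚᵘ p * ℚ.fromℚᵘ q ≡ ℚ.fromℚᵘ (p ℚᵘ.* q)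
fromℚᵘ-homo-* p q = ℚ.toℚᵘ-injective
  (ℚᵘ.≃-trans (ℚ.toℚᵘ-homo-* (ℚ.fromℚᵘ p) (ℚ.fromℚᵘ q))
  (ℚᵘ.≃-trans (ℚᵘ.*-cong (ℚ.toℚᵘ-fromℚᵘ p) (ℚ.toℚᵘ-fromℚᵘ q))
  (ℚᵘ.≃-sym (ℚ.toℚᵘ-fromℚᵘ (p ℚᵘ.* q)))))

ι≡/1 : ∀ n → ι n ≡ (ℤ.+ n) ℚ./ 1
ι≡/1 zero    = refl
ι≡/1 (suc n) = begin
  1ℚ + ι n                             ≡⟨ cong (1ℚ +_) (ι≡/1 n) ⟩
  1ℚ + (ℤ.+ n) ℚ./ 1                   ≡⟨ fromℚᵘ-homo-+ ℚᵘ.1ℚᵘ (ℚᵘ.mkℚᵘ (ℤ.+ n) 0) ⟩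
  (ℤ.+ 1 ℤ.+ ℤ.+ n ℤ.* ℤ.+ 1) ℚ./ 1    ≡⟨ cong (λ z → (ℤ.+ 1 ℤ.+ z) ℚ./ 1) (ℤ.*-identityʳ (ℤ.+ n)) ⟩
  (ℤ.+ suc n) ℚ./ 1                    ∎

recip : (n : ℕ) .{{_ : NonZero n}} → ℚ
recip n = (ℤ.+ 1) ℚ./ n

recip-* : ∀ m n .{{_ : NonZero m}} .{{_ : NonZero n}} .{{_ : NonZero (m ℕ.* n)}} →
          recip (m ℕ.* n) ≡ recip m * recip n
recip-* (suc m) (suc n) = sym (fromℚᵘ-homo-* (ℚᵘ.mkℚᵘ (ℤ.+ 1) m) (ℚᵘ.mkℚᵘ (ℤ.+ 1) n))

ι*recip : ∀ n .{{_ : NonZero n}} → ι n * recip n ≡ 1ℚ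
ι*recip (suc n) = begin
  ι (suc n) * recip (suc n)                  ≡⟨ cong (_* recip (suc n)) (ι≡/1 (suc n)) ⟩
  (ℤ.+ suc n) ℚ./ 1 * recip (suc n)          ≡⟨ fromℚᵘ-homo-* (ℚᵘ.mkℚᵘ (ℤ.+ suc n) 0) (ℚᵘ.mkℚᵘ (ℤ.+ 1) n) ⟩
  ℚ.fromℚᵘ (ℚᵘ.mkℚᵘ (ℤ.+ suc n) 0 ℚᵘ.* ℚᵘ.mkℚᵘ (ℤ.+ 1) n)
    ≡⟨ ℚ.fromℚᵘ-cong {ℚᵘ.mkℚᵘ (ℤ.+ suc n) 0 ℚᵘ.* ℚᵘ.mkℚᵘ (ℤ.+ 1) n} {ℚᵘ.1ℚᵘ} (ℚᵘ.*≡* (cong ℤ.+_ (begin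
         suc n ℕ.* 1 ℕ.* 1  ≡⟨ ℕ.*-identityʳ (suc n ℕ.* 1) ⟩
         suc n ℕ.* 1        ≡⟨ ℕ.*-comm (suc n) 1 ⟩
         1 ℕ.* suc n        ≡⟨ cong (1 ℕ.*_) (ℕ.*-identityˡ (suc n)) ⟨
         1 ℕ.* (1 ℕ.* suc n) ∎))) ⟩
  ℚ.fromℚᵘ ℚᵘ.1ℚᵘ ∎

1/!_ : ℕ → ℚ
1/! n = recip (n !) {{ n ℕ.!≢0 }}

1/!-* : ∀ a b → 1/[ a !* b !] ≡ 1/! a * 1/! b
1/!-* a b = recip-* (a !) (b !) {{a ℕ.!≢0}} {{b ℕ.!≢0}} {{a ℕ.!* b !≢0}}

ι*1/! : ∀ n → ι (suc n) * 1/! suc n ≡ 1/! n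
ι*1/! n = begin
  ι (suc n) * 1/! suc n                     ≡⟨ cong (ι (suc n) *_) (recip-* (suc n) (n !) {{_}} {{n ℕ.!≢0}} {{suc n ℕ.!≢0}}) ⟩
  ι (suc n) * (recip (suc n) * 1/! n)       ≡⟨ ℚ.*-assoc (ι (suc n)) (recip (suc n)) (1/! n) ⟨
  ι (suc n) * recip (suc n) * 1/! n         ≡⟨ cong (_* 1/! n) (ι*recip (suc n)) ⟩
  1ℚ * 1/! n                                ≡⟨ ℚ.*-identityˡ (1/! n) ⟩
  1/! n                                     ∎

-- 1/(y - i)!, which is 0 for y < i.
invFact : ℕ → ℕ → ℚ
invFact y       zero    = 1/! y
invFact zero    (suc i) = 0ℚ
invFact (suc y) (suc i) = invFact y i

-- Lowering y divides (y - r)! by y - r, where r = `suc i`; the term with r stands on the left to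
-- avoid subtraction. With r = 0 the identity would fail at y = 0, since `pred 0` is 0.
invFact-pred : ∀ y i → invFact (pred y) (suc i) + ι (suc i) * invFact y (suc i) ≡ ι y * invFact y (suc i)
invFact-pred zero          i       = trans (ℚ.+-identityˡ (ι (suc i) * 0ℚ))
                                     (trans (ℚ.*-zeroʳ (ι (suc i))) (sym (ℚ.*-zeroˡ 0ℚ)))
invFact-pred (suc zero)    zero    = refl
invFact-pred (suc (suc y)) zero    = begin
  1/! y + ι 1 * x          ≡⟨ cong (_+ ι 1 * x) (ι*1/! y) ⟨
  ι (suc y) * x + ι 1 * x  ≡⟨ solve 2 (λ a x → a :* x :+ con 1ℚ :* x := (con 1ℚ :+ a) :* x) refl (ι (suc y)) x ⟩
  ι (2 ℕ.+ y) * x          ∎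
  where x = 1/! suc y
invFact-pred (suc zero)    (suc i) = trans (ℚ.+-identityˡ (ι (2 ℕ.+ i) * 0ℚ))
  (trans (ℚ.*-zeroʳ (ι (2 ℕ.+ i))) (sym (ℚ.*-zeroʳ (ι 1))))
invFact-pred (suc (suc y)) (suc i) = begin
  u + (1ℚ + ι (suc i)) * x    ≡⟨ solve 3 (λ u i x → u :+ (con 1ℚ :+ i) :* x := x :+ (u :+ i :* x)) refl u (ι (suc i)) x ⟩
  x + (u + ι (suc i) * x)     ≡⟨ cong (x +_) (invFact-pred (suc y) i) ⟩
  x + ι (suc y) * x           ≡⟨ solve 2 (λ a x → x :+ a :* x := (con 1ℚ :+ a) :* x) refl (ι (suc y)) x ⟩
  ι (2 ℕ.+ y) * x             ∎
  where
  u = invFact y (suc i)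
  x = invFact y i

invFact-diag : ∀ i → invFact i i ≡ 1ℚ
invFact-diag zero    = refl
invFact-diag (suc i) = invFact-diag i

invFact-< : ∀ {y i} → y < i → invFact y i ≡ 0ℚ
invFact-< {zero}  (s≤s _)   = refl
invFact-< {suc y} (s≤s y<i) = invFact-< y<i

-- Determinants of inverse factorials.

interval : ℕ → ℕ → List ℕ
interval zero    i = []
interval (suc n) i = i ∷ interval n (suc i)

-- det (1/(y_s - r)!) with rows r = i, ..., i + n - 1; it is 0 if there are not
-- exactly n columns y_s.
factorialDet : ℕ → ℕ → List ℕ → ℚ
factorialDet zero    i []      = 1ℚ
factorialDet zero    i (_ ∷ _) = 0ℚ
factorialDet (suc n) i ys      = altSum ys (λ y zs → invFact y i * factorialDet n (suc i) zs)

-- In each product of the expansion, lowering the column matched with row r multiplies by y - r.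
-- These factors add up to the sum of the columns minus the sum of the rows, whichever matching is
-- taken.
factorialDet-pred : ∀ n i ys →
  deriv pred (factorialDet n (suc i)) ys + ι (sum (interval n (suc i))) * factorialDet n (suc i) ys ≡ ι (sum ys) * factorialDet n (suc i) ys
factorialDet-pred zero    i []       = refl
factorialDet-pred zero    i (y ∷ ys) = begin
  0ℚ + deriv pred (λ _ → 0ℚ) ys + 0ℚ * 0ℚ  ≡⟨ cong (λ x → 0ℚ + x + 0ℚ * 0ℚ) (0-homo (deriv-linear pred ys)) ⟩
  0ℚ                                       ≡⟨ ℚ.*-zeroʳ (ι (y ℕ.+ sum ys)) ⟨
  ι (y ℕ.+ sum ys) * 0ℚ                    ∎
factorialDet-pred (suc n) i ys = begin
  deriv pred (λ zs → altSum zs F) ys + R * altSum ys F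
    ≡⟨ cong₂ _+_ (deriv-altSum pred F ys) (sym (*-homo (altSum-linear ys) R (uncurry F))) ⟩
  altSum ys (λ y zs → F (pred y) zs + deriv pred (F y) zs) + altSum ys (λ y zs → R * F y zs)
    ≡⟨ +-homo (altSum-linear ys) (λ (y , zs) → F (pred y) zs + deriv pred (F y) zs) (λ (y , zs) → R * F y zs) ⟨
  altSum ys (λ y zs → (F (pred y) zs + deriv pred (F y) zs) + R * F y zs)
    ≡⟨ altSum-cong ys (λ y zs eq → trans (step y zs) (cong (λ s → ι s * F y zs) eq)) ⟩
  altSum ys (λ y zs → ι (sum ys) * F y zs)
    ≡⟨ *-homo (altSum-linear ys) (ι (sum ys)) (uncurry F) ⟩
  ι (sum ys) * altSum ys F ∎
  where
  D = factorialDet n (suc (suc i))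
  F : ℕ → List ℕ → ℚ
  F y zs = invFact y (suc i) * D zs
  R = ι (suc i ℕ.+ sum (interval n (suc (suc i))))
  step : ∀ y zs → (F (pred y) zs + deriv pred (F y) zs) + R * F y zs ≡ ι (y ℕ.+ sum zs) * F y zs
  step y zs = begin
    (p * d + deriv pred (F y) zs) + R * (c * d)
      ≡⟨ cong₂ (λ u v → (p * d + u) + v * (c * d)) (*-homo (deriv-linear pred zs) c D)
           (ι-+ (suc i) (sum (interval n (suc (suc i))))) ⟩
    (p * d + c * d′) + (a + e) * (c * d)
      ≡⟨ solve 6 (λ p d c d′ a e → (p :* d :+ c :* d′) :+ (a :+ e) :* (c :* d)
                               := (p :+ a :* c) :* d :+ c :* (d′ :+ e :* d)) refl p d c d′ a e ⟩
    (p + a * c) * d + c * (d′ + e * d)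
      ≡⟨ cong₂ (λ u v → u * d + c * v) (invFact-pred y i) (factorialDet-pred n (suc i) zs) ⟩
    (ι y * c) * d + c * (ι (sum zs) * d)
      ≡⟨ solve 4 (λ y c d s → (y :* c) :* d :+ c :* (s :* d) := (y :+ s) :* (c :* d)) refl (ι y) c d (ι (sum zs)) ⟩
    (ι y + ι (sum zs)) * (c * d)
      ≡⟨ cong (_* (c * d)) (ι-+ y (sum zs)) ⟨
    ι (y ℕ.+ sum zs) * (c * d) ∎
    where
    p = invFact (pred y) (suc i)
    c = invFact y (suc i)
    d = D zs
    d′ = deriv pred D zs
    a = ι (suc i)
    e = ι (sum (interval n (suc (suc i))))

factorialDet-swap : ∀ n i {p ys ys′} → Swap p ys ys′ → factorialDet n i ys ≡ - factorialDet n i ys′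
factorialDet-swap zero    i here      = refl
factorialDet-swap zero    i (there σ) = refl
factorialDet-swap (suc n) i σ         = altSum-swap (λ y {_} {zs} {zs′} τ →
  trans (cong (invFact y i *_) (factorialDet-swap n (suc i) τ)) (sym (ℚ.neg-distribʳ-* (invFact y i) (factorialDet n (suc i) zs′)))) σ

-- Every entry 1/(y - r)! of the first column has r ≥ i > y.
factorialDet-zeroColumn : ∀ n {i y} ys → y < i → factorialDet n i (y ∷ ys) ≡ 0ℚ
factorialDet-zeroColumn zero            ys y<i = refl
factorialDet-zeroColumn (suc n) {i} {y} ys y<i = begin
  invFact y i * factorialDet n (suc i) ys + - altSum ys (λ z zs → invFact z i * factorialDet n (suc i) (y ∷ zs))
    ≡⟨ cong₂ (λ u v → u * factorialDet n (suc i) ys + - v) (invFact-< y<i)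
         (trans (altSum-cong ys (λ z zs _ → trans (cong (invFact z i *_) (factorialDet-zeroColumn n zs (ℕ.m<n⇒m<1+n y<i)))
                                             (ℚ.*-zeroʳ (invFact z i))))
                (0-homo (altSum-linear ys))) ⟩
  0ℚ * factorialDet n (suc i) ys + - 0ℚ
    ≡⟨ cong (_+ - 0ℚ) (ℚ.*-zeroˡ (factorialDet n (suc i) ys)) ⟩
  0ℚ ∎

-- The matrix of the 1/(s - r)! is unitriangular: a term that does not remove column `i` in row `i`
-- keeps it for the later rows, where it vanishes.
factorialDet-interval : ∀ n i → factorialDet n i (interval n i) ≡ 1ℚ
factorialDet-interval zero    i = refl
factorialDet-interval (suc n) i = begin
  invFact i i * factorialDet n (suc i) (interval n (suc i)) + - altSum ys (λ z zs → invFact z i * factorialDet n (suc i) (i ∷ zs))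
    ≡⟨ cong₂ (λ u v → u + - v) (cong₂ _*_ (invFact-diag i) (factorialDet-interval n (suc i)))
         (trans (altSum-cong ys (λ z zs _ → trans (cong (invFact z i *_) (factorialDet-zeroColumn n zs (ℕ.n<1+n i)))
                                             (ℚ.*-zeroʳ (invFact z i))))
                (0-homo (altSum-linear ys))) ⟩
  1ℚ * 1ℚ + - 0ℚ ∎
  where ys = interval n (suc i)

length-interval : ∀ n i → length (interval n i) ≡ n
length-interval zero    i = refl
length-interval (suc n) i = cong suc (length-interval n (suc i))

interval-positive : ∀ n i → All (1 ≤_) (interval n (suc i))
interval-positive zero    i = []
interval-positive (suc n) i = s≤s z≤n ∷ interval-positive n (suc i)

-- Indexed sums, states and block sums.

σ : ℕ → (ℕ → ℚ) → ℚ
σ n f = ∑ {n} (λ i → f (toℕ i))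

σ-cong : ∀ n {f g} → (∀ i → i < n → f i ≡ g i) → σ n f ≡ σ n g
σ-cong zero    eq = refl
σ-cong (suc n) eq = cong₂ _+_ (eq 0 (s≤s z≤n)) (σ-cong n λ i i<n → eq (suc i) (s≤s i<n))

∑-linear : ∀ n → Linear (∑ {n})
∑-linear zero    = zero-linear
∑-linear (suc n) = +-linear (evaluation zero) (pullback-linear (∑-linear n) suc)

σ-linear : ∀ n → Linear (σ n)
σ-linear n = pullback-linear (∑-linear n) toℕ

σ-indicator : ∀ m c (f : ℕ → ℚ) → σ m (λ j → if does (c ℕ.≟ j) then f j else 0ℚ)
                      ≡ (if does (c ℕ.<? m) then f c else 0ℚ)
σ-indicator zero    c       f = refl
σ-indicator (suc m) zero    f = trans (cong (f 0 +_) (0-homo (σ-linear m))) (ℚ.+-identityʳ (f 0))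
σ-indicator (suc m) (suc c) f = trans (ℚ.+-identityˡ (σ m (λ j → if does (c ℕ.≟ j) then f (suc j) else 0ℚ)))
                                      (σ-indicator m c (f ∘ suc))

deriv-σ : ∀ φ f ys → deriv φ f ys ≡ σ (length ys) (λ j → f (at φ j ys))
deriv-σ φ f []       = refl
deriv-σ φ f (y ∷ ys) = cong (f (φ y ∷ ys) +_) (deriv-σ φ (f ∘ (y ∷_)) ys)

-- In the state reached after reading a prefix of a permutation, the entry of a
-- value u is nothing if u has been used, and otherwise just c, where c is the
-- maximal length of an ascending subsequence of the prefix with all values
-- below u.
State : ℕ → Set
State = Vec (Maybe ℕ)

unplaced : ∀ {n} → State n → ℕ
unplaced []            = 0
unplaced (nothing ∷ s) = unplaced s
unplaced (just _ ∷ s)  = suc (unplaced s)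

-- The sum of f over all distributions of the unused values to the positions of
-- ys, where a value with entry c may only go to a position ≥ c, and each value
-- increments the position it goes to.
blockSum : ∀ {n} → (List ℕ → ℚ) → List ℕ → State n → ℚ
blockSum f ys []            = f ys
blockSum f ys (nothing ∷ s) = blockSum f ys s
blockSum f ys (just c ∷ s)  = incSum c ys (λ zs → blockSum f zs s)

blockSum-done : ∀ {n} f ys (s : State n) → unplaced s ≡ 0 → blockSum f ys s ≡ f ys
blockSum-done f ys []            eq = refl
blockSum-done f ys (nothing ∷ s) eq = blockSum-done f ys s eq

blockSum-pred : ∀ {n f} R → (∀ ys → deriv pred f ys + R * f ys ≡ ι (sum ys) * f ys) →
  ∀ {ys} (s : State n) → All (1 ≤_) ys →
  deriv pred (λ zs → blockSum f zs s) ys + R * blockSum f ys s ≡ ι (sum ys ℕ.+ unplaced s) * blockSum f ys s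
blockSum-pred {f = f} R eq {ys} []  ps = trans (eq ys) (cong (λ n → ι n * f ys) (sym (ℕ.+-identityʳ (sum ys))))
blockSum-pred R eq (nothing ∷ s) ps = blockSum-pred R eq s ps
blockSum-pred {f = f} R eq {ys} (just c ∷ s) ps = begin
  deriv pred (λ zs → incSum c zs g) ys + R * incSum c ys g
    ≡⟨ cong₂ _+_ (deriv-pred-incSum c ps g) (sym (*-homo U R g)) ⟩
  incSum c ys (deriv pred g) + incSum c ys (λ zs → R * g zs)
    ≡⟨ +-homo U (deriv pred g) (λ zs → R * g zs) ⟨
  incSum c ys (λ zs → deriv pred g zs + R * g zs)
    ≡⟨ incSum-cong c ys (λ j j< → trans (blockSum-pred R eq s (positive-at-suc j ps))
         (cong (λ n → ι n * g (at suc j ys))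
           (trans (cong (ℕ._+ unplaced s) (sum-at-suc j ys j<)) (sym (ℕ.+-suc (sum ys) (unplaced s)))))) ⟩
  incSum c ys (λ zs → ι (sum ys ℕ.+ suc (unplaced s)) * g zs)
    ≡⟨ *-homo U (ι (sum ys ℕ.+ suc (unplaced s))) g ⟩
  ι (sum ys ℕ.+ suc (unplaced s)) * incSum c ys g ∎
  where
  U = incSum-linear c ys
  g = λ zs → blockSum f zs s

bump : ∀ {n} → ℕ → State n → State n
bump j = Vec.map (Maybe.map (λ c → if does (c ℕ.≟ j) then suc c else c))

-- The part of placeSum that chooses a letter with entry j; on sorted states
-- bump j and raise j agree.
placeAt : ∀ {n} → ℕ → State n → (State n → ℚ) → ℚ
placeAt j []            F = 0ℚ
placeAt j (nothing ∷ s) F = placeAt j s (F ∘ (nothing ∷_))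
placeAt j (just c ∷ s)  F = (if does (c ℕ.≟ j) then F (nothing ∷ bump j s) else 0ℚ)
                          + placeAt j s (F ∘ (just c ∷_))

if-linear : ∀ b {X : Set} {L M : (X → ℚ) → ℚ} → Linear L → Linear M → Linear (λ F → if b then L F else M F)
if-linear true  l m = l
if-linear false l m = m

placeAt-linear : ∀ {n} j (s : State n) → Linear (placeAt j s)
placeAt-linear j []            = zero-linear
placeAt-linear j (nothing ∷ s) = pullback-linear (placeAt-linear j s) (nothing ∷_)
placeAt-linear j (just c ∷ s)  = +-linear
  (if-linear (does (c ℕ.≟ j)) (evaluation (nothing ∷ bump j s)) zero-linear)
  (pullback-linear (placeAt-linear j s) (just c ∷_))

length-at : ∀ φ j ys → length (at φ j ys) ≡ length ys
length-at φ j       []       = refl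
length-at φ zero    (y ∷ ys) = refl
length-at φ (suc j) (y ∷ ys) = cong suc (length-at φ j ys)

-- Distributions that use position j for a value with entry j, classified by the
-- last such value.
blockSum-bump : ∀ {n} f j {ys} (s : State n) → j < length ys →
         blockSum f ys s ≡ blockSum f ys (bump j s) + placeAt j s (blockSum f (at suc j ys))
blockSum-bump f j {ys} []            j< = sym (ℚ.+-identityʳ (f ys))
blockSum-bump f j      (nothing ∷ s) j< = blockSum-bump f j s j<
blockSum-bump f j {ys} (just c ∷ s)  j< = trans split (cases (c ℕ.≟ j))
  where
  g = λ zs → blockSum f zs (bump j s)
  P = placeAt j s (λ s′ → blockSum f (at suc j ys) (just c ∷ s′))
  split : incSum c ys (λ zs → blockSum f zs s) ≡ incSum c ys g + P
  split = begin
    incSum c ys (λ zs → blockSum f zs s)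
      ≡⟨ incSum-cong c ys (λ i i< → blockSum-bump f j s (subst (j <_) (sym (length-at suc i ys)) j<)) ⟩
    incSum c ys (λ zs → g zs + placeAt j s (blockSum f (at suc j zs)))
      ≡⟨ +-homo (incSum-linear c ys) g (λ zs → placeAt j s (blockSum f (at suc j zs))) ⟩
    incSum c ys g + incSum c ys (λ zs → placeAt j s (blockSum f (at suc j zs)))
      ≡⟨ cong (incSum c ys g +_) (begin
           incSum c ys (λ zs → placeAt j s (blockSum f (at suc j zs)))
             ≡⟨ incSum-exchange (placeAt-linear j s) c ys (λ s′ zs → blockSum f (at suc j zs) s′) ⟨
           placeAt j s (λ s′ → incSum c ys (λ zs → blockSum f (at suc j zs) s′))
             ≡⟨ ≗-cong (placeAt-linear j s) (λ s′ → sym (incSum-at c j ys (λ zs → blockSum f zs s′))) ⟩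
           P ∎) ⟩
    incSum c ys g + P ∎
  cases : ∀ d → incSum c ys g + P ≡ incSum (if does d then suc c else c) ys g
                                  + ((if does d then g (at suc j ys) else 0ℚ) + P)
  cases (no _)     = cong (incSum c ys g +_) (sym (ℚ.+-identityˡ P))
  -- The head value either uses position `j` itself, and is then the last value with entry `j` to do
  -- so, or goes to a later position.
  cases (yes refl) = begin
    incSum j ys g + P                                 ≡⟨ cong (_+ P) (incSum-split j ys g j<) ⟩
    (g (at suc j ys) + incSum (suc j) ys g) + P
      ≡⟨ solve 3 (λ a b p → (a :+ b) :+ p := b :+ (a :+ p)) refl (g (at suc j ys)) (incSum (suc j) ys g) P ⟩
    incSum (suc j) ys g + (g (at suc j ys) + P)       ∎

Avoids : ∀ {n} → ℕ → State n → Set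
Avoids j = VecAll.All (MaybeAll.All (_≢ j))

bump-avoids : ∀ {n} j (s : State n) → Avoids j (bump j s)
bump-avoids j []            = []
bump-avoids j (nothing ∷ s) = MaybeAll.nothing ∷ bump-avoids j s
bump-avoids j (just c ∷ s)  = MaybeAll.just (avoid (c ℕ.≟ j)) ∷ bump-avoids j s
  where
  avoid : ∀ d → (if does d then suc c else c) ≢ j
  avoid (yes refl) = ℕ.1+n≢n
  avoid (no c≢j)   = c≢j

-- No value has entry 0, so the head position receives nothing and `f` is only evaluated at lists
-- with head 0.
blockSum-zeroHead : ∀ {n f} → (∀ ys → f (0 ∷ ys) ≡ 0ℚ) → ∀ {ys} (s : State n) → Avoids 0 s → blockSum f (0 ∷ ys) s ≡ 0ℚ
blockSum-zeroHead z []                 av       = z _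
blockSum-zeroHead z (nothing ∷ s)      (_ ∷ av) = blockSum-zeroHead z s av
blockSum-zeroHead z (just zero ∷ s)    (MaybeAll.just c≢0 ∷ av) = contradiction refl c≢0
blockSum-zeroHead z {ys} (just (suc c) ∷ s) (_ ∷ av) =
  trans (≗-cong U (λ zs → blockSum-zeroHead z s av)) (0-homo U)
  where U = incSum-linear c ys

blockSum-swap : ∀ {n f p} → (∀ {ys ys′} → Swap p ys ys′ → f ys ≡ - f ys′) →
         (s : State n) → Avoids (suc p) s → ∀ {ys ys′} → Swap p ys ys′ → blockSum f ys s ≡ - blockSum f ys′ s
blockSum-swap anti []            av                    σ = anti σ
blockSum-swap anti (nothing ∷ s) (_ ∷ av)              σ = blockSum-swap anti s av σ
blockSum-swap anti (just c ∷ s)  (MaybeAll.just c≢ ∷ av)  σ = incSum-swap (blockSum-swap anti s av) c c≢ σ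

self-opposite : ∀ {x} → x ≡ - x → x ≡ 0ℚ
self-opposite {x} eq = begin
  x               ≡⟨ solve 1 (λ x → x := con ℚ.½ :* (x :+ x)) refl x ⟩
  ℚ.½ * (x + x)   ≡⟨ cong (λ y → ℚ.½ * (x + y)) eq ⟩
  ℚ.½ * (x + - x) ≡⟨ cong (ℚ.½ *_) (ℚ.+-inverseʳ x) ⟩
  0ℚ              ∎

interval-swap : ∀ {n p} i → suc p < n → Swap p (at pred (suc p) (interval n i)) (at pred (suc p) (interval n i))
interval-swap {suc (suc n)} {zero}  i _         = here
interval-swap {suc n}       {suc p} i (s≤s p<n) = there (interval-swap (suc i) p<n)

at-suc-pred : ∀ j {ys} → All (1 ≤_) ys → at suc j (at pred j ys) ≡ ys
at-suc-pred j       []                 = refl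
at-suc-pred zero    {suc y ∷ ys} (_ ∷ ps) = refl
at-suc-pred (suc j) {y ∷ ys}     (_ ∷ ps) = cong (y ∷_) (at-suc-pred j ps)

-- The recursion for block sums at the staircase.

module _ (m : ℕ) where

  staircase = interval m 1
  alternant = factorialDet m 1

  -- Lowering entry j ≥ 1 of the staircase makes the columns j - 1 and j equal;
  -- no value distinguishes these two positions, so swapping them changes the sign.
  blockSum-vanish : ∀ {n} j → j < m → (s : State n) → Avoids j s → blockSum alternant (at pred j staircase) s ≡ 0ℚ
  blockSum-vanish zero    (s≤s _) s av = blockSum-zeroHead (λ ys → factorialDet-zeroColumn m ys (s≤s z≤n)) s av
  blockSum-vanish (suc p) p<m     s av = self-opposite (blockSum-swap (factorialDet-swap m 1) s av (interval-swap 1 p<m))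

  -- This is `blockSum-bump` at the staircase with entry `j` lowered. The part in which no value
  -- with entry `j` goes to position `j` vanishes; in the other part the chosen value restores the
  -- lowered entry.
  placeAt-blockSum : ∀ {n} j → j < m → (s : State n) → placeAt j s (blockSum alternant staircase) ≡ blockSum alternant (at pred j staircase) s
  placeAt-blockSum j j<m s = begin
    placeAt j s (blockSum alternant staircase)
      ≡⟨ cong (λ ys → placeAt j s (blockSum alternant ys)) (at-suc-pred j (interval-positive m 0)) ⟨
    placeAt j s (blockSum alternant (at suc j staircase′))
      ≡⟨ ℚ.+-identityˡ (placeAt j s (blockSum alternant (at suc j staircase′))) ⟨
    0ℚ + placeAt j s (blockSum alternant (at suc j staircase′))
      ≡⟨ cong (_+ placeAt j s (blockSum alternant (at suc j staircase′))) (blockSum-vanish j j<m (bump j s) (bump-avoids j s)) ⟨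
    blockSum alternant staircase′ (bump j s) + placeAt j s (blockSum alternant (at suc j staircase′))
      ≡⟨ blockSum-bump alternant j s (subst (j <_) (sym (trans (length-at pred j staircase) (length-interval m 1))) j<m) ⟨
    blockSum alternant staircase′ s ∎
    where staircase′ = at pred j staircase

  σ-placeAt : ∀ {n} (s : State n) → σ m (λ j → placeAt j s (blockSum alternant staircase)) ≡ ι (unplaced s) * blockSum alternant staircase s
  σ-placeAt s = begin
    σ m (λ j → placeAt j s (blockSum alternant staircase))          ≡⟨ σ-cong m (λ j j<m → placeAt-blockSum j j<m s) ⟩
    σ m (λ j → blockSum alternant (at pred j staircase) s)
      ≡⟨ cong (λ k → σ k (λ j → blockSum alternant (at pred j staircase) s)) (length-interval m 1) ⟨
    σ (length staircase) (λ j → blockSum alternant (at pred j staircase) s) ≡⟨ deriv-σ pred (λ zs → blockSum alternant zs s) staircase ⟨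
    D                                        ≡⟨ solve 3 (λ d r t → d := (d :+ r :* t) :+ :- (r :* t)) refl D R t ⟩
    (D + R * t) + - (R * t)                  ≡⟨ cong (_+ - (R * t)) (blockSum-pred R (factorialDet-pred m 0) s (interval-positive m 0)) ⟩
    ι (sum staircase ℕ.+ unplaced s) * t + - (R * t) ≡⟨ cong (λ x → x * t + - (R * t)) (ι-+ (sum staircase) (unplaced s)) ⟩
    (R + ι (unplaced s)) * t + - (R * t)     ≡⟨ solve 3 (λ r u t → (r :+ u) :* t :+ :- (r :* t) := u :* t) refl R (ι (unplaced s)) t ⟩
    ι (unplaced s) * t                       ∎
    where
    D = deriv pred (λ zs → blockSum alternant zs s) staircase
    R = ι (sum staircase)
    t = blockSum alternant staircase s

-- Reading one letter, and the number of completions.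

raise : ∀ {n} → ℕ → State n → State n
raise c = Vec.map (Maybe.map (suc c ⊔_))

placeSum : ∀ {n} → ℕ → State n → (State n → ℚ) → ℚ
placeSum m []            F = 0ℚ
placeSum m (nothing ∷ s) F = placeSum m s (F ∘ (nothing ∷_))
placeSum m (just c ∷ s)  F = (if does (c ℕ.<? m) then F (nothing ∷ raise c s) else 0ℚ)
                           + placeSum m s (F ∘ (just c ∷_))

placeSum-linear : ∀ {n} m (s : State n) → Linear (placeSum m s)
placeSum-linear m []            = zero-linear
placeSum-linear m (nothing ∷ s) = pullback-linear (placeSum-linear m s) (nothing ∷_)
placeSum-linear m (just c ∷ s)  = +-linear
  (if-linear (does (c ℕ.<? m)) (evaluation (nothing ∷ raise c s)) zero-linear)
  (pullback-linear (placeSum-linear m s) (just c ∷_))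

LowerBound : ∀ {n} → ℕ → State n → Set
LowerBound b = VecAll.All (MaybeAll.All (b ≤_))

data Sorted : ∀ {n} → State n → Set where
  []   : Sorted []
  skip : ∀ {n} {s : State n} → Sorted s → Sorted (nothing ∷ s)
  _∷_  : ∀ {n c} {s : State n} → LowerBound c s → Sorted s → Sorted (just c ∷ s)

raise-lowerBound : ∀ {n b} c {s : State n} → LowerBound b s → LowerBound b (raise c s)
raise-lowerBound c []                  = []
raise-lowerBound c (MaybeAll.nothing ∷ l) = MaybeAll.nothing ∷ raise-lowerBound c l
raise-lowerBound c (_∷_ {x = just d} (MaybeAll.just b≤) l)  = MaybeAll.just (ℕ.≤-trans b≤ (ℕ.m≤n⊔m (suc c) d)) ∷ raise-lowerBound c l

raise-mono : ∀ {n b} c {s : State n} → LowerBound b s → LowerBound (suc c ⊔ b) (raise c s)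
raise-mono c []                  = []
raise-mono c (MaybeAll.nothing ∷ l) = MaybeAll.nothing ∷ raise-mono c l
raise-mono c (MaybeAll.just b≤ ∷ l) = MaybeAll.just (ℕ.⊔-monoʳ-≤ (suc c) b≤) ∷ raise-mono c l

raise-sorted : ∀ {n} c {s : State n} → Sorted s → Sorted (raise c s)
raise-sorted c []       = []
raise-sorted c (skip so) = skip (raise-sorted c so)
raise-sorted c (l ∷ so) = raise-mono c l ∷ raise-sorted c so

unplaced-raise : ∀ {n} c (s : State n) → unplaced (raise c s) ≡ unplaced s
unplaced-raise c []            = refl
unplaced-raise c (nothing ∷ s) = unplaced-raise c s
unplaced-raise c (just _ ∷ s)  = cong suc (unplaced-raise c s)

raise≡bump : ∀ {n c} {s : State n} → LowerBound c s → raise c s ≡ bump c s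
raise≡bump         []                                      = refl
raise≡bump         (MaybeAll.nothing ∷ l)                     = cong (nothing ∷_) (raise≡bump l)
raise≡bump {c = c} (_∷_ {x = just d} (MaybeAll.just c≤d) l) = cong₂ (λ x t → just x ∷ t) (go (d ℕ.≟ c)) (raise≡bump l)
  where
  go : ∀ e → suc c ⊔ d ≡ (if does e then suc d else d)
  go (yes refl) = ℕ.m≥n⇒m⊔n≡m (ℕ.n≤1+n c)
  go (no d≢c)   = ℕ.m≤n⇒m⊔n≡n (ℕ.≤∧≢⇒< c≤d (d≢c ∘ sym))

-- The clause on `LowerBound` carries the induction: it keeps the bound of a head entry valid for
-- the changed tail, which therefore stays sorted below that head.
placeSum-cong : ∀ {n} m {s : State n} {F G} → Sorted s →
  (∀ {s′} → Sorted s′ → (∀ {b} → LowerBound b s → LowerBound b s′) → suc (unplaced s′) ≡ unplaced s →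
    F s′ ≡ G s′) →
  placeSum m s F ≡ placeSum m s G
placeSum-cong m []        eq = refl
placeSum-cong m (skip so) eq = placeSum-cong m so λ so′ lb u →
  eq (skip so′) (λ { (MaybeAll.nothing ∷ l) → MaybeAll.nothing ∷ lb l }) u
placeSum-cong m {just c ∷ s} (l ∷ so) eq = cong₂ _+_
  (cong (λ x → if does (c ℕ.<? m) then x else 0ℚ)
    (eq (skip (raise-sorted c so)) (λ { (_ ∷ l′) → MaybeAll.nothing ∷ raise-lowerBound c l′ })
        (cong suc (unplaced-raise c s))))
  (placeSum-cong m so λ so′ lb u →
    eq (lb l ∷ so′) (λ { (p ∷ l′) → p ∷ lb l′ }) (cong suc u))

-- The permitted next letters are grouped by their entry `j < m`. Sortedness makes `raise` and
-- `bump` agree behind the chosen letter.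
placeSum≡σ : ∀ {n} m {s : State n} → Sorted s → ∀ F → placeSum m s F ≡ σ m (λ j → placeAt j s F)
placeSum≡σ m []        F = sym (0-homo (σ-linear m))
placeSum≡σ m (skip so) F = placeSum≡σ m so (F ∘ (nothing ∷_))
placeSum≡σ m {just c ∷ s} (l ∷ so) F = begin
  (if does (c ℕ.<? m) then F (nothing ∷ raise c s) else 0ℚ) + placeSum m s F′
    ≡⟨ cong₂ _+_ (cong (λ t → if does (c ℕ.<? m) then F (nothing ∷ t) else 0ℚ) (raise≡bump l)) (placeSum≡σ m so F′) ⟩
  (if does (c ℕ.<? m) then G c else 0ℚ) + σ m (λ j → placeAt j s F′)
    ≡⟨ cong (_+ σ m (λ j → placeAt j s F′)) (σ-indicator m c G) ⟨
  σ m (λ j → if does (c ℕ.≟ j) then G j else 0ℚ) + σ m (λ j → placeAt j s F′)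
    ≡⟨ +-homo (σ-linear m) (λ j → if does (c ℕ.≟ j) then G j else 0ℚ) (λ j → placeAt j s F′) ⟨
  σ m (λ j → placeAt j (just c ∷ s) F) ∎
  where
  F′ = F ∘ (just c ∷_)
  G = λ j → F (nothing ∷ bump j s)

completions : ∀ {n} → ℕ → ℕ → State n → ℚ
completions m zero    s = 1ℚ
completions m (suc k) s = placeSum m s (completions m k)

ι-* : ∀ m n → ι (m ℕ.* n) ≡ ι m * ι n
ι-* zero    n = sym (ℚ.*-zeroˡ (ι n))
ι-* (suc m) n = begin
  ι (n ℕ.+ m ℕ.* n)    ≡⟨ ι-+ n (m ℕ.* n) ⟩
  ι n + ι (m ℕ.* n)    ≡⟨ cong (ι n +_) (ι-* m n) ⟩
  ι n + ι m * ι n      ≡⟨ solve 2 (λ m n → n :+ m :* n := (con 1ℚ :+ m) :* n) refl (ι m) (ι n) ⟩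
  (1ℚ + ι m) * ι n     ∎

-- Each letter contributes the factor `ι (unplaced s)` of `σ-placeAt`, and these accumulate to
-- `k !`. When no value is left, the determinant at the staircase is 1.
completions-blockSum : ∀ {n} m k {s : State n} → Sorted s → unplaced s ≡ k → completions m k s ≡ ι (k !) * blockSum (alternant m) (staircase m) s
completions-blockSum m zero    {s} so u = sym (trans (cong (1ℚ *_) (blockSum-done (alternant m) (staircase m) s u))
                                      (cong (1ℚ *_) (factorialDet-interval m 1)))
completions-blockSum m (suc k) {s} so u = begin
  placeSum m s (completions m k)
    ≡⟨ placeSum-cong m so (λ so′ _ u′ → completions-blockSum m k so′ (ℕ.suc-injective (trans u′ u))) ⟩
  placeSum m s (λ s′ → ι (k !) * t s′)
    ≡⟨ *-homo (placeSum-linear m s) (ι (k !)) t ⟩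
  ι (k !) * placeSum m s t
    ≡⟨ cong (ι (k !) *_) (placeSum≡σ m so t) ⟩
  ι (k !) * σ m (λ j → placeAt j s t)
    ≡⟨ cong (ι (k !) *_) (trans (σ-placeAt m s) (cong (λ n → ι n * t s) u)) ⟩
  ι (k !) * (ι (suc k) * t s)
    ≡⟨ solve 3 (λ a b t → a :* (b :* t) := (b :* a) :* t) refl (ι (k !)) (ι (suc k)) (t s) ⟩
  (ι (suc k) * ι (k !)) * t s
    ≡⟨ cong (_* t s) (ι-* (suc k) (k !)) ⟨
  ι (suc k !) * t s ∎
  where t = blockSum (alternant m) (staircase m)

-- Counting words letter by letter through states.

-- The result is `nothing` if the letter has been used, or if reading it would complete an ascending
-- subsequence of length `m + 1`.
place : ∀ {n} → ℕ → State n → Fin n → Maybe (State n)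
place m (x ∷ s)       (suc v) = Maybe.map (x ∷_) (place m s v)
place m (nothing ∷ s) zero    = nothing
place m (just c ∷ s)  zero    = if does (c ℕ.<? m) then just (nothing ∷ raise c s) else nothing

survives : ∀ {n k} → ℕ → State n → Vec (Fin n) k → Bool
survives m s []      = true
survives m s (v ∷ w) = maybe′ (λ s′ → survives m s′ w) false (place m s v)

lsum : {A : Set} → List A → (A → ℚ) → ℚ
lsum []       f = 0ℚ
lsum (x ∷ xs) f = f x + lsum xs f

lsum-cong : ∀ {A : Set} (xs : List A) {f g} → f ≗ g → lsum xs f ≡ lsum xs g
lsum-cong []       eq = refl
lsum-cong (x ∷ xs) eq = cong₂ _+_ (eq x) (lsum-cong xs eq)

lsum-zero : ∀ {A : Set} (xs : List A) → lsum xs (λ _ → 0ℚ) ≡ 0ℚ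
lsum-zero []       = refl
lsum-zero (x ∷ xs) = trans (ℚ.+-identityˡ (lsum xs (λ _ → 0ℚ))) (lsum-zero xs)

lsum-++ : ∀ {A : Set} (xs ys : List A) f → lsum (xs ++ ys) f ≡ lsum xs f + lsum ys f
lsum-++ []       ys f = sym (ℚ.+-identityˡ (lsum ys f))
lsum-++ (x ∷ xs) ys f = trans (cong (f x +_) (lsum-++ xs ys f)) (sym (ℚ.+-assoc (f x) (lsum xs f) (lsum ys f)))

lsum-map : ∀ {A B : Set} (g : A → B) xs f → lsum (List.map g xs) f ≡ lsum xs (f ∘ g)
lsum-map g []       f = refl
lsum-map g (x ∷ xs) f = cong (f (g x) +_) (lsum-map g xs f)

lsum-cartesianProductWith : ∀ {A B C : Set} (h : A → B → C) xs ys f →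
  lsum (cartesianProductWith h xs ys) f ≡ lsum xs (λ x → lsum ys (λ y → f (h x y)))
lsum-cartesianProductWith h []       ys f = refl
lsum-cartesianProductWith h (x ∷ xs) ys f = trans
  (lsum-++ (List.map (h x) ys) (cartesianProductWith h xs ys) f)
  (cong₂ _+_ (lsum-map (h x) ys f) (lsum-cartesianProductWith h xs ys f))

lsum-tabulate : ∀ {A : Set} n (g : Fin n → A) f → lsum (tabulate g) f ≡ ∑ (f ∘ g)
lsum-tabulate zero    g f = refl
lsum-tabulate (suc n) g f = cong (f (g zero) +_) (lsum-tabulate n (g ∘ suc) f)

maybe-map : ∀ {A B : Set} (f : B → ℚ) (g : A → B) x → maybe′ f 0ℚ (Maybe.map g x) ≡ maybe′ (f ∘ g) 0ℚ x
maybe-map f g (just _) = refl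
maybe-map f g nothing  = refl

maybe-if : ∀ {A : Set} (f : A → ℚ) b x → maybe′ f 0ℚ (if b then just x else nothing) ≡ (if b then f x else 0ℚ)
maybe-if f true  x = refl
maybe-if f false x = refl

∑-place : ∀ {n} m (s : State n) F → ∑ (λ v → maybe′ F 0ℚ (place m s v)) ≡ placeSum m s F
∑-place         m []            F = refl
∑-place {suc n} m (nothing ∷ s) F = trans
  (ℚ.+-identityˡ (∑ (λ v → maybe′ F 0ℚ (place m (nothing ∷ s) (suc v)))))
  (trans (≗-cong (∑-linear n) (λ v → maybe-map F (nothing ∷_) (place m s v))) (∑-place m s (F ∘ (nothing ∷_))))
∑-place {suc n} m (just c ∷ s)  F = cong₂ _+_
  (maybe-if F (does (c ℕ.<? m)) (nothing ∷ raise c s))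
  (trans (≗-cong (∑-linear n) (λ v → maybe-map F (just c ∷_) (place m s v))) (∑-place m s (F ∘ (just c ∷_))))

indicator : Bool → ℚ
indicator b = if b then 1ℚ else 0ℚ

lsum-survives : ∀ {n} m k (s : State n) → lsum (words n k) (indicator ∘ survives m s) ≡ completions m k s
lsum-survives     m zero    s = refl
lsum-survives {n} m (suc k) s = begin
  lsum (words n (suc k)) (indicator ∘ survives m s)
    ≡⟨ lsum-cartesianProductWith _∷_ (allFin n) (words n k) (indicator ∘ survives m s) ⟩
  lsum (allFin n) (λ v → lsum (words n k) (λ w → indicator (survives m s (v ∷ w))))
    ≡⟨ lsum-tabulate n id (λ v → lsum (words n k) (λ w → indicator (survives m s (v ∷ w)))) ⟩
  ∑ (λ v → lsum (words n k) (λ w → indicator (survives m s (v ∷ w))))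
    ≡⟨ ≗-cong (∑-linear n) (λ v → continue (place m s v)) ⟩
  ∑ (λ v → maybe′ (completions m k) 0ℚ (place m s v))
    ≡⟨ ∑-place m s (completions m k) ⟩
  placeSum m s (completions m k) ∎
  where
  continue : ∀ x → lsum (words n k) (λ w → indicator (maybe′ (λ s′ → survives m s′ w) false x))
                 ≡ maybe′ (completions m k) 0ℚ x
  continue (just s′) = lsum-survives m k s′
  continue nothing   = lsum-zero (words n k)

-- Surviving words are the permutations without long ascending subsequences.

-- A transition described by lookups alone, so that the correctness proofs need not follow the
-- recursion of `place`.
record Placed {n} (c : ℕ) (v : Fin n) (s s′ : State n) : Set where
  field
    was   : lookup s v ≡ just c
    taken : lookup s′ v ≡ nothing
    below : ∀ {u} → u Fin.< v → lookup s′ u ≡ lookup s u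
    above : ∀ {u} → v Fin.< u → lookup s′ u ≡ Maybe.map (suc c ⊔_) (lookup s u)

open Placed

Placed-suc : ∀ {n c v x} {s s′ : State n} → Placed c v s s′ → Placed c (suc v) (x ∷ s) (x ∷ s′)
Placed-suc p = record
  { was   = was p
  ; taken = taken p
  ; below = λ { {zero} _ → refl ; {suc u} (s≤s u<v) → below p u<v }
  ; above = λ { {suc u} (s≤s v<u) → above p v<u }
  }

place-sound : ∀ {n} m (s : State n) v {s′} → place m s v ≡ just s′ → ∃ λ c → c < m × Placed c v s s′
place-sound m (just c ∷ s) zero eq with c ℕ.<ᵇ m in c<ᵇm
place-sound m (just c ∷ s) zero refl | true = c , ℕ.<ᵇ⇒< c m (subst Bool.T (sym c<ᵇm) _) , record
  { was   = refl
  ; taken = refl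
  ; below = λ ()
  ; above = λ { {suc u} _ → lookup-map u (Maybe.map (suc c ⊔_)) s }
  }
place-sound m (x ∷ s) (suc v) eq with place m s v in eq′
place-sound m (x ∷ s) (suc v) refl | just s′ =
  let c , c<m , p = place-sound m s v eq′ in c , c<m , Placed-suc p

place-complete : ∀ {n m c} (s : State n) v → lookup s v ≡ just c → c < m → ∃ λ s′ → place m s v ≡ just s′
place-complete {m = m} {c} (just c ∷ s) zero refl c<m rewrite dec-true (c ℕ.<? m) c<m = _ , refl
place-complete (x ∷ s) (suc v) eq c<m =
  let s′ , eq′ = place-complete s v eq c<m in x ∷ s′ , cong (Maybe.map (x ∷_)) eq′

-- Chain u r w: w has an ascending subsequence that starts with the value u and
-- has r further letters.
data Chain {n} : ∀ {k} → Fin n → ℕ → Vec (Fin n) k → Set where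
  here : ∀ {k u} {w : Vec (Fin n) k} → Chain u 0 (u ∷ w)
  cons : ∀ {k u v r} {w : Vec (Fin n) k} → u Fin.< v → Chain v r w → Chain u (suc r) (u ∷ w)
  skip : ∀ {k u v r} {w : Vec (Fin n) k} → Chain u r w → Chain u r (v ∷ w)

Chain-head : ∀ {n k u r} {w : Vec (Fin n) k} → Chain u r w → ∃ λ i → lookup w i ≡ u
Chain-head here       = zero , refl
Chain-head (cons _ _) = zero , refl
Chain-head (skip ch)  = let i , eq = Chain-head ch in suc i , eq

-- In `short`, `c` letters of the prefix with values below `u`, followed by the `suc r` letters of
-- the chain, make an ascending subsequence of `r + c + 1` letters; this length must not exceed `m`.
record Good {n k} (m : ℕ) (s : State n) (w : Vec (Fin n) k) : Set where
  field
    distinct : ∀ {i j} → lookup w i ≡ lookup w j → i ≡ j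
    free     : ∀ i → ∃ λ c → lookup s (lookup w i) ≡ just c
    short    : ∀ {u c r} → Chain u r w → lookup s u ≡ just c → r ℕ.+ c < m

open Good

map-just⁻¹ : ∀ {A B : Set} {f : A → B} x {y} → Maybe.map f x ≡ just y → ∃ λ z → x ≡ just z × f z ≡ y
map-just⁻¹ (just z) refl = z , refl , refl

nothing≢just : ∀ {A : Set} {x : A} {y} → y ≡ nothing → y ≢ just x
nothing≢just refl ()

survives⇒Good : ∀ {n k} m (s : State n) (w : Vec (Fin n) k) → survives m s w ≡ true → Good m s w
survives⇒Good m s []      _  = record { distinct = λ { {()} } ; free = λ () ; short = λ () }
survives⇒Good m s (v ∷ w) eq with place m s v in placed
... | just s′ = record { distinct = distinct′ _ _ ; free = free′ ; short = short′ }
  where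
  good = survives⇒Good m s′ w eq
  sound = place-sound m s v placed
  c = proj₁ sound
  c<m = proj₁ (proj₂ sound)
  p = proj₂ (proj₂ sound)

  fresh : ∀ i → lookup w i ≢ v
  fresh i eq = nothing≢just (taken p) (trans (cong (lookup s′) (sym eq)) (proj₂ (free good i)))

  distinct′ : ∀ i j → lookup (v ∷ w) i ≡ lookup (v ∷ w) j → i ≡ j
  distinct′ zero    zero    _  = refl
  distinct′ zero    (suc j) eq = contradiction (sym eq) (fresh j)
  distinct′ (suc i) zero    eq = contradiction eq (fresh i)
  distinct′ (suc i) (suc j) eq = cong suc (distinct good eq)

  free′ : ∀ i → ∃ λ c → lookup s (lookup (v ∷ w) i) ≡ just c
  free′ zero    = c , was p
  free′ (suc i) with free good i | Fin.<-cmp (lookup w i) v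
  ... | d , eq | tri< u<v _ _ = d , trans (sym (below p u<v)) eq
  ... | d , eq | tri≈ _ u≡v _ = contradiction u≡v (fresh i)
  ... | d , eq | tri> _ _ v<u =
    let e , eq′ , _ = map-just⁻¹ (lookup s (lookup w i)) (trans (sym (above p v<u)) eq) in e , eq′

  short′ : ∀ {u d r} → Chain u r (v ∷ w) → lookup s u ≡ just d → r ℕ.+ d < m
  short′ here eq with refl ← trans (sym (was p)) eq = c<m
  -- The next letter of the chain lies above `v`, so its entry after `v` is read is at least
  -- `suc d`, which accounts for the letter `v` itself.
  short′ {d = d} (cons {v = u} {r = r} v<u ch) eq with refl ← trans (sym (was p)) eq =
    let i , at-i = Chain-head ch
        e , eq-e = free good i
        eq-u = trans (cong (lookup s′) (sym at-i)) eq-e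
        x , _ , max≡e = map-just⁻¹ (lookup s u) (trans (sym (above p v<u)) eq-u)
    in ℕ.≤-<-trans
         (ℕ.≤-trans (ℕ.≤-reflexive (sym (ℕ.+-suc r d)))
           (ℕ.+-monoʳ-≤ r (ℕ.≤-trans (ℕ.m≤m⊔n (suc d) x) (ℕ.≤-reflexive max≡e))))
         (short good ch eq-u)
  short′ {u} {d} {r} (skip ch) eq with Chain-head ch | Fin.<-cmp u v
  ... | _        | tri< u<v _ _ = short good ch (trans (below p u<v) eq)
  ... | i , at-i | tri≈ _ u≡v _ = contradiction (trans at-i u≡v) (fresh i)
  ... | _        | tri> _ _ v<u = ℕ.≤-<-trans (ℕ.+-monoʳ-≤ r (ℕ.m≤n⊔m (suc c) d))
    (short good ch (trans (above p v<u) (cong (Maybe.map (suc c ⊔_)) eq)))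

Good⇒survives : ∀ {n k} m (s : State n) (w : Vec (Fin n) k) → Good m s w → survives m s w ≡ true
Good⇒survives m s []      good = refl
Good⇒survives m s (v ∷ w) good with free good zero
... | c₀ , eq₀ with place-complete s v eq₀ (short good here eq₀)
... | s′ , placed rewrite placed = Good⇒survives m s′ w (record
  { distinct = Fin.suc-injective ∘ distinct good
  ; free     = free′
  ; short    = short′
  })
  where
  sound = place-sound m s v placed
  c = proj₁ sound
  p = proj₂ (proj₂ sound)

  fresh : ∀ i → lookup w i ≢ v
  fresh i eq with () ← distinct good {suc i} {zero} eq

  free′ : ∀ i → ∃ λ d → lookup s′ (lookup w i) ≡ just d
  free′ i with free good (suc i) | Fin.<-cmp (lookup w i) v
  ... | d , eq | tri< u<v _ _ = d , trans (below p u<v) eq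
  ... | d , eq | tri≈ _ u≡v _ = contradiction u≡v (fresh i)
  ... | d , eq | tri> _ _ v<u = suc c ⊔ d , trans (above p v<u) (cong (Maybe.map (suc c ⊔_)) eq)

  short′ : ∀ {u d r} → Chain u r w → lookup s′ u ≡ just d → r ℕ.+ d < m
  short′ {u} {d} {r} ch eq with Chain-head ch | Fin.<-cmp u v
  ... | _        | tri< u<v _ _ = short good (skip ch) (trans (sym (below p u<v)) eq)
  ... | i , at-i | tri≈ _ u≡v _ = contradiction (trans at-i u≡v) (fresh i)
  ... | _        | tri> _ _ v<u with map-just⁻¹ (lookup s u) (trans (sym (above p v<u)) eq)
  -- The new entry is the maximum of `suc c` and `e`: the first is controlled by the chain with `v`
  -- put in front, the second by the chain that skips `v`.
  ...   | e , eq-e , refl = subst (_< m) (sym (ℕ.+-distribˡ-⊔ r (suc c) e))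
    (ℕ.⊔-pres-<m (subst (_< m) (sym (ℕ.+-suc r c)) (short good (cons v<u ch) (was p)))
               (short good (skip ch) eq-e))

-- `IsAscending` for words of any length, since the inductions pass to the tail of the word.
Ascending : ∀ {n k r} → Vec (Fin n) k → (Fin r → Fin k) → Set
Ascending w i = i Preserves Fin._<_ ⟶ Fin._<_ × (lookup w ∘ i) Preserves Fin._<_ ⟶ Fin._<_

Chain⇒Ascending : ∀ {n k u r} {w : Vec (Fin n) k} → Chain u r w →
  ∃ λ (i : Fin (suc r) → Fin k) → Ascending w i × lookup w (i zero) ≡ u
Chain⇒Ascending here =
  (λ _ → zero) , ((λ { {zero} {zero} () ; {zero} {suc ()} _ ; {suc ()} _ }) , (λ { {zero} {zero} () ; {zero} {suc ()} _ ; {suc ()} _ })) , refl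
Chain⇒Ascending {k = suc k} {u} {suc r} {u ∷ w} (cons {v = v} u<v ch)
  with i , (up , asc) , at-v ← Chain⇒Ascending ch = i′ , (up′ , asc′) , refl
  where
  i′ : Fin (2 ℕ.+ r) → Fin (suc k)
  i′ zero    = zero
  i′ (suc x) = suc (i x)

  up′ : i′ Preserves Fin._<_ ⟶ Fin._<_
  up′ {zero}  {suc y} _         = s≤s z≤n
  up′ {suc x} {suc y} (s≤s x<y) = s≤s (up x<y)

  asc′ : (lookup (u ∷ w) ∘ i′) Preserves Fin._<_ ⟶ Fin._<_
  asc′ {zero}  {suc zero}    _         = subst (u Fin.<_) (sym at-v) u<v
  asc′ {zero}  {suc (suc y)} _         = Fin.<-trans (subst (u Fin.<_) (sym at-v) u<v) (asc (s≤s z≤n))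
  asc′ {suc x} {suc y}       (s≤s x<y) = asc x<y
Chain⇒Ascending (skip ch) =
  let i , (up , asc) , at-u = Chain⇒Ascending ch
  in suc ∘ i , ((λ x<y → s≤s (up x<y)) , asc) , at-u

lower : ∀ {r k} (i : Fin r → Fin (suc k)) → (∀ x → zero ≢ i x) →
        ∃ λ (j : Fin r → Fin k) → ∀ x → i x ≡ suc (j x)
lower i i≢0 = (λ x → punchOut (i≢0 x)) , (λ x → sym (Fin.punchIn-punchOut (i≢0 x)))

-- If the first position is not 0, monotonicity keeps all positions in the tail; if it is 0, all the
-- remaining positions lie in the tail.
Ascending⇒Chain : ∀ {n k r} (w : Vec (Fin n) k) (i : Fin (suc r) → Fin k) → Ascending w i →
                  Chain (lookup w (i zero)) r w
Ascending⇒Chain []      i (up , asc) with () ← i zero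
Ascending⇒Chain {r = r} (v ∷ w) i (up , asc) with i zero in eq₀
... | suc i₀ = skip (subst (λ u → Chain u r w) (sym (cong (lookup w) (Fin.suc-injective (trans (sym eq₀) (eq zero)))))
    (Ascending⇒Chain w j
      ( (λ {x} {y} x<y → ℕ.s<s⁻¹ (subst₂ Fin._<_ (eq x) (eq y) (up x<y)))
      , (λ {x} {y} x<y → subst₂ (λ a b → lookup (v ∷ w) a Fin.< lookup (v ∷ w) b) (eq x) (eq y) (asc x<y)))))
  where
  nonzero : ∀ x → zero ≢ i x
  nonzero zero    0≡i with () ← trans 0≡i eq₀
  nonzero (suc x) 0≡i with () ← subst (i zero Fin.<_) (sym 0≡i) (up (s≤s z≤n))
  shifted = lower i nonzero
  j = proj₁ shifted
  eq = proj₂ shifted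
Ascending⇒Chain {r = zero}  (v ∷ w) i (up , asc) | zero = here
Ascending⇒Chain {r = suc r} (v ∷ w) i (up , asc) | zero = cons
    (subst₂ Fin._<_ (cong (lookup (v ∷ w)) eq₀) (cong (lookup (v ∷ w)) (eq zero)) (asc {zero} {suc zero} (s≤s z≤n)))
    (Ascending⇒Chain w j
      ( (λ {x} {y} x<y → ℕ.s<s⁻¹ (subst₂ Fin._<_ (eq x) (eq y) (up (s≤s x<y))))
      , (λ {x} {y} x<y → subst₂ (λ a b → lookup (v ∷ w) a Fin.< lookup (v ∷ w) b) (eq x) (eq y) (asc (s≤s x<y)))))
  where
  nonzero : ∀ x → zero ≢ i (suc x)
  nonzero x 0≡i with () ← subst (i zero Fin.<_) (sym 0≡i) (up (s≤s z≤n))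
  shifted = lower (i ∘ suc) nonzero
  j = proj₁ shifted
  eq = proj₂ shifted

-- If `y` were missed, removing it from the codomain would leave an injection from `Fin (suc n)`
-- into `Fin n`.
injective⇒surjective : ∀ {n} {f : Fin n → Fin n} → Injective _≡_ _≡_ f → Surjective _≡_ _≡_ f
injective⇒surjective {suc n} {f} inj y with Fin.any? (λ x → f x Fin.≟ y)
... | yes (x , fx≡y) = x , λ { refl → fx≡y }
... | no ∄x = contradiction
  (Fin.injective⇒≤ {f = λ x → punchOut (≢y x)} λ {a} {b} eq → inj (Fin.punchOut-injective (≢y a) (≢y b) eq))
  ℕ.1+n≰n
  where
  ≢y : ∀ x → y ≢ f x
  ≢y x y≡fx = ∄x (x , sym y≡fx)

fresh : ∀ n → State n
fresh n = replicate n (just 0)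

In𝔖⇒Good : ∀ {n} m (τ : Vec (Fin n) n) → In𝔖 m τ → Good m (fresh n) τ
In𝔖⇒Good {n} m τ ((inj , _) , avoids) = record
  { distinct = inj
  ; free     = λ i → 0 , lookup-replicate (lookup τ i) (just 0)
  ; short    = short′
  }
  where
  short′ : ∀ {u c r} → Chain u r τ → lookup (fresh n) u ≡ just c → r ℕ.+ c < m
  short′ {u} {c} {r} ch eq with refl ← trans (sym (lookup-replicate u (just 0))) eq =
    ℕ.≰⇒> λ m≤r → avoids (truncate (subst (m ≤_) (ℕ.+-identityʳ r) m≤r))
    where
    truncate : m ≤ r → HasAscending (suc m) τ
    -- The chain has `suc r` letters; the first `suc m` of them already form a forbidden
    -- subsequence.
    truncate m≤r =
      let i , (up , asc) , _ = Chain⇒Ascending ch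
          ↑ = λ x → Fin.inject≤ x (s≤s m≤r)
          ↑-mono : ↑ Preserves Fin._<_ ⟶ Fin._<_
          ↑-mono {x} {y} x<y = subst₂ _<_ (sym (Fin.toℕ-inject≤ x (s≤s m≤r))) (sym (Fin.toℕ-inject≤ y (s≤s m≤r))) x<y
      in i ∘ ↑ , (λ x<y → up (↑-mono x<y)) , (λ x<y → asc (↑-mono x<y))

Good⇒In𝔖 : ∀ {n} m (τ : Vec (Fin n) n) → Good m (fresh n) τ → In𝔖 m τ
Good⇒In𝔖 {n} m τ good = (distinct good , injective⇒surjective (distinct good)) , λ (i , asc) →
  -- The chain has `m` letters after its first one, whose entry is 0, so `short` would give
  -- `m + 0 < m`.
  ℕ.<-irrefl (ℕ.+-identityʳ m)
    (short good (Ascending⇒Chain τ i asc) (lookup-replicate (lookup τ (i zero)) (just 0)))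

in𝔖?-survives : ∀ {n} m (τ : Vec (Fin n) n) → does (in𝔖? m τ) ≡ survives m (fresh n) τ
in𝔖?-survives {n} m τ with survives m (fresh n) τ in eq
... | true  = dec-true (in𝔖? m τ) (Good⇒In𝔖 m τ (survives⇒Good m (fresh n) τ eq))
... | false = dec-false (in𝔖? m τ) λ τ∈𝔖 →
  contradiction (trans (sym eq) (Good⇒survives m (fresh n) τ (In𝔖⇒Good m τ τ∈𝔖))) λ ()

-- The terms of the left-hand side as block sums.

-- `permTerm` depends only on the length of the permutation, so the summand is a constant series and
-- the sum is a multiple of it by a count.
sumₛ-filter : ∀ {A : Set} {P : A → Set} (P? : ∀ x → Dec (P x)) (f : Series) xs k →
  sumₛ (List.map (λ _ → f) (filter P? xs)) k ≡ lsum xs (λ x → indicator (does (P? x))) * f k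
sumₛ-filter P? f []       k = sym (ℚ.*-zeroˡ (f k))
sumₛ-filter P? f (x ∷ xs) k with does (P? x)
... | true  = trans (cong₂ _+_ (sym (ℚ.*-identityˡ (f k))) (sumₛ-filter P? f xs k))
                    (sym (ℚ.*-distribʳ-+ (f k) 1ℚ (lsum xs (λ x → indicator (does (P? x))))))
... | false = trans (sumₛ-filter P? f xs k)
                    (cong (_* f k) (sym (ℚ.+-identityˡ (lsum xs (λ x → indicator (does (P? x)))))))

fresh-sorted : ∀ n → Sorted (fresh n)
fresh-sorted zero    = []
fresh-sorted (suc n) = fresh-bound n ∷ fresh-sorted n
  where
  fresh-bound : ∀ n → LowerBound 0 (fresh n)
  fresh-bound zero    = []
  fresh-bound (suc n) = MaybeAll.just z≤n ∷ fresh-bound n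

unplaced-fresh : ∀ n → unplaced (fresh n) ≡ n
unplaced-fresh zero    = refl
unplaced-fresh (suc n) = cong suc (unplaced-fresh n)

lhsTerm-blockSum : ∀ m n k → lhsTerm m n k ≡ (ι (n !) * blockSum (alternant m) (staircase m) (fresh n)) * monomial 1/[ n !* n !] (2 ℕ.* n) k
lhsTerm-blockSum m n k = begin
  lhsTerm m n k
    ≡⟨ sumₛ-filter (in𝔖? m) (monomial 1/[ n !* n !] (2 ℕ.* n)) (words n n) k ⟩
  lsum (words n n) (λ τ → indicator (does (in𝔖? m τ))) * M
    ≡⟨ cong (_* M) (lsum-cong (words n n) (λ τ → cong indicator (in𝔖?-survives m τ))) ⟩
  lsum (words n n) (indicator ∘ survives m (fresh n)) * M
    ≡⟨ cong (_* M) (trans (lsum-survives m n (fresh n)) (completions-blockSum m n (fresh-sorted n) (unplaced-fresh n))) ⟩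
  (ι (n !) * blockSum (alternant m) (staircase m) (fresh n)) * M ∎
  where
  M = monomial 1/[ n !* n !] (2 ℕ.* n) k

-- Power series: products, shifts and the substitution of t² for t.

tail : Series → Series
tail f k = f (suc k)

-- `(f ⊛ g) (suc k)` unfolds to `f 0 * g (suc k) + (tail f ⊛ g) k`; inductions on products use this
-- recursion.
⊛-linearˡ : ∀ g k → Linear (λ f → (f ⊛ g) k)
⊛-linearˡ g zero    = +-linear (scaleʳ-linear (evaluation 0) (g 0)) zero-linear
⊛-linearˡ g (suc k) = +-linear (scaleʳ-linear (evaluation 0) (g (suc k))) (pullback-linear (⊛-linearˡ g k) suc)

⊛-linearʳ : ∀ f k → Linear (λ g → (f ⊛ g) k)
⊛-linearʳ f zero    = +-linear (scale-linear (evaluation 0) (f 0)) zero-linear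
⊛-linearʳ f (suc k) = +-linear (scale-linear (evaluation (suc k)) (f 0)) (⊛-linearʳ (tail f) k)

⊛-cong : ∀ {f f′ g g′} → f ≗ f′ → g ≗ g′ → f ⊛ g ≗ f′ ⊛ g′
⊛-cong {f} {f′} {g} {g′} f≗f′ g≗g′ k =
  trans (≗-cong (⊛-linearˡ g k) f≗f′) (≗-cong (⊛-linearʳ f′ k) g≗g′)

shift : Series → Series
shift f zero    = 0ℚ
shift f (suc k) = f k

-- Multiplication by t^a.
shiftBy : ℕ → Series → Series
shiftBy zero    f = f
shiftBy (suc a) f = shift (shiftBy a f)

shiftBy-linear : ∀ a k → Linear (λ f → shiftBy a f k)
shiftBy-linear zero    k       = evaluation k
shiftBy-linear (suc a) zero    = zero-linear
shiftBy-linear (suc a) (suc k) = shiftBy-linear a k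

shiftBy-+ : ∀ a b f → shiftBy a (shiftBy b f) ≡ shiftBy (a ℕ.+ b) f
shiftBy-+ zero    b f = refl
shiftBy-+ (suc a) b f = cong shift (shiftBy-+ a b f)

shiftBy-injective : ∀ a {f g} → shiftBy a f ≗ shiftBy a g → f ≗ g
shiftBy-injective zero    eq = eq
shiftBy-injective (suc a) eq = shiftBy-injective a (eq ∘ suc)

shift-cong : ∀ {f g} → f ≗ g → shift f ≗ shift g
shift-cong eq zero    = refl
shift-cong eq (suc k) = eq k

⊛-shiftˡ : ∀ f g → shift f ⊛ g ≗ shift (f ⊛ g)
⊛-shiftˡ f g zero    = trans (ℚ.+-identityʳ (0ℚ * g 0)) (ℚ.*-zeroˡ (g 0))
⊛-shiftˡ f g (suc k) = trans (cong (_+ (f ⊛ g) k) (ℚ.*-zeroˡ (g (suc k)))) (ℚ.+-identityˡ ((f ⊛ g) k))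

⊛-shiftʳ : ∀ f g → f ⊛ shift g ≗ shift (f ⊛ g)
⊛-shiftʳ f g zero          = trans (ℚ.+-identityʳ (f 0 * 0ℚ)) (ℚ.*-zeroʳ (f 0))
⊛-shiftʳ f g (suc zero)    = cong (f 0 * g 0 +_) (⊛-shiftʳ (tail f) g 0)
⊛-shiftʳ f g (suc (suc k)) = cong (f 0 * g (suc k) +_) (⊛-shiftʳ (tail f) g (suc k))

⊛-shiftBy : ∀ a b f g → shiftBy a f ⊛ shiftBy b g ≗ shiftBy (a ℕ.+ b) (f ⊛ g)
⊛-shiftBy zero    zero    f g k = refl
⊛-shiftBy zero    (suc b) f g k = trans (⊛-shiftʳ f (shiftBy b g) k) (shift-cong (⊛-shiftBy zero b f g) k)
⊛-shiftBy (suc a) b       f g k = trans (⊛-shiftˡ (shiftBy a f) (shiftBy b g) k) (shift-cong (⊛-shiftBy a b f g) k)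

-- f(t) ↦ f(t²)
square : Series → Series
square f zero          = f 0
square f (suc zero)    = 0ℚ
square f (suc (suc k)) = square (tail f) k

square-linear : ∀ k → Linear (λ f → square f k)
square-linear zero          = evaluation 0
square-linear (suc zero)    = zero-linear
square-linear (suc (suc k)) = pullback-linear (square-linear k) suc

square-⊛ : ∀ f g → square f ⊛ square g ≗ square (f ⊛ g)
square-⊛ f g zero          = refl
square-⊛ f g (suc zero)    =
  solve 2 (λ x y → x :* con 0ℚ :+ (con 0ℚ :* y :+ con 0ℚ) := con 0ℚ) refl (f 0) (g 0)
square-⊛ f g (suc (suc k)) = begin
  f 0 * square (tail g) k + (0ℚ * square g (suc k) + (square (tail f) ⊛ square g) k)
    ≡⟨ cong (λ x → f 0 * square (tail g) k + x)
         (trans (cong₂ _+_ (ℚ.*-zeroˡ (square g (suc k))) (square-⊛ (tail f) g k))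
                (ℚ.+-identityˡ (square (tail f ⊛ g) k))) ⟩
  f 0 * square (tail g) k + square (tail f ⊛ g) k
    ≡⟨ cong (_+ square (tail f ⊛ g) k) (*-homo (square-linear k) (f 0) (tail g)) ⟨
  square (λ n → f 0 * tail g n) k + square (tail f ⊛ g) k
    ≡⟨ +-homo (square-linear k) (λ n → f 0 * tail g n) (tail f ⊛ g) ⟨
  square (tail (f ⊛ g)) k ∎

-- Unlike `2 * n`, it unfolds by two successors at a time, as the recursion of `square` does.
double : ℕ → ℕ
double zero    = zero
double (suc n) = suc (suc (double n))

double≡+ : ∀ n → double n ≡ n ℕ.+ n
double≡+ zero    = refl
double≡+ (suc n) = cong suc (trans (cong suc (double≡+ n)) (sym (ℕ.+-suc n n)))

square-shift : ∀ f → square (shift f) ≗ shift (shift (square f))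
square-shift f zero          = refl
square-shift f (suc zero)    = refl
square-shift f (suc (suc k)) = refl

square-shiftBy : ∀ d f → square (shiftBy d f) ≗ shiftBy (double d) (square f)
square-shiftBy zero    f k = refl
square-shiftBy (suc d) f k = trans (square-shift (shiftBy d f) k)
  (shift-cong (shift-cong (square-shiftBy d f)) k)

-- Exponential generating functions.

-- The product of exponential generating functions, defined by the Leibniz rule.
bconv : Series → Series → Series
bconv f g zero    = f 0 * g 0
bconv f g (suc n) = bconv (tail f) g n + bconv f (tail g) n

bconv-linearʳ : ∀ f n → Linear (λ g → bconv f g n)
bconv-linearʳ f zero    = scale-linear (evaluation 0) (f 0)
bconv-linearʳ f (suc n) = +-linear (bconv-linearʳ (tail f) n) (pullback-linear (bconv-linearʳ f n) suc)

bconv-congˡ : ∀ {f f′} g n → f ≗ f′ → bconv f g n ≡ bconv f′ g n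
bconv-congˡ g zero    eq = cong (_* g 0) (eq 0)
bconv-congˡ g (suc n) eq = cong₂ _+_ (bconv-congˡ g n (eq ∘ suc)) (bconv-congˡ (tail g) n eq)

egf : Series → Series
egf f n = f n * 1/! n

-- t d/dt
θ : Series → Series
θ f n = ι n * f n

θ-⊛ : ∀ f g n → θ (f ⊛ g) n ≡ (θ f ⊛ g) n + (f ⊛ θ g) n
θ-⊛ f g zero    = solve 2 (λ x y → con 0ℚ :* (x :* y :+ con 0ℚ)
                    := (con 0ℚ :* x) :* y :+ con 0ℚ :+ (x :* (con 0ℚ :* y) :+ con 0ℚ)) refl (f 0) (g 0)
θ-⊛ f g (suc n) = begin
  (1ℚ + ι n) * (x * y + c)
    ≡⟨ solve 4 (λ i x y c → (con 1ℚ :+ i) :* (x :* y :+ c)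
                         := (con 1ℚ :+ i) :* (x :* y) :+ (c :+ i :* c)) refl (ι n) x y c ⟩
  (1ℚ + ι n) * (x * y) + (c + ι n * c)
    ≡⟨ cong (λ z → (1ℚ + ι n) * (x * y) + (c + z)) (θ-⊛ (tail f) g n) ⟩
  (1ℚ + ι n) * (x * y) + (c + (d + e))
    ≡⟨ solve 6 (λ i x y c d e → (con 1ℚ :+ i) :* (x :* y) :+ (c :+ (d :+ e))
                             := ((con 0ℚ :* x) :* y :+ (c :+ d)) :+ (x :* ((con 1ℚ :+ i) :* y) :+ e))
         refl (ι n) x y c d e ⟩
  ((0ℚ * x) * y + (c + d)) + (x * ((1ℚ + ι n) * y) + e)
    ≡⟨ cong (λ z → ((0ℚ * x) * y + z) + (x * ((1ℚ + ι n) * y) + e)) (begin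
         c + d
           ≡⟨ +-homo (⊛-linearˡ g n) (tail f) (θ (tail f)) ⟨
         ((λ k → tail f k + θ (tail f) k) ⊛ g) n
           ≡⟨ ≗-cong (⊛-linearˡ g n) (λ k → solve 2 (λ i z → z :+ i :* z := (con 1ℚ :+ i) :* z) refl (ι k) (tail f k)) ⟩
         (tail (θ f) ⊛ g) n ∎) ⟩
  (θ f ⊛ g) (suc n) + (f ⊛ θ g) (suc n) ∎
  where
  x = f 0
  y = g (suc n)
  c = (tail f ⊛ g) n
  d = (θ (tail f) ⊛ g) n
  e = (tail f ⊛ θ g) n

θ-egf : ∀ f → θ (egf f) ≗ shift (egf (tail f))
θ-egf f zero    = ℚ.*-zeroˡ (egf f 0)
θ-egf f (suc n) = trans
  (solve 3 (λ i x w → i :* (x :* w) := x :* (i :* w)) refl (ι (suc n)) (f (suc n)) (1/! suc n))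
  (cong (f (suc n) *_) (ι*1/! n))

-- Coefficient `suc n` of a series is `recip (suc n)` times that of its `θ`. On `⊛` the operator `θ`
-- obeys the product rule, and on an `egf` it takes the `tail` of the sequence, which matches the
-- recursion of `bconv`.
egf-bconv : ∀ f g → egf (bconv f g) ≗ egf f ⊛ egf g
egf-bconv f g zero    = solve 2 (λ x y → (x :* y) :* con 1ℚ := (x :* con 1ℚ) :* (y :* con 1ℚ) :+ con 0ℚ) refl (f 0) (g 0)
egf-bconv f g (suc n) = begin
  b * 1/! suc n
    ≡⟨ cong (b *_) (recip-* (suc n) (n !) {{_}} {{n ℕ.!≢0}} {{suc n ℕ.!≢0}}) ⟩
  b * (ρ * 1/! n)
    ≡⟨ solve 3 (λ b ρ w → b :* (ρ :* w) := ρ :* (b :* w)) refl b ρ (1/! n) ⟩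
  ρ * (b * 1/! n)
    ≡⟨ cong (ρ *_) (begin
         b * 1/! n
           ≡⟨ ℚ.*-distribʳ-+ (1/! n) (bconv (tail f) g n) (bconv f (tail g) n) ⟩
         egf (bconv (tail f) g) n + egf (bconv f (tail g)) n
           ≡⟨ cong₂ _+_ (egf-bconv (tail f) g n) (egf-bconv f (tail g) n) ⟩
         (egf (tail f) ⊛ egf g) n + (egf f ⊛ egf (tail g)) n
           ≡⟨ cong₂ _+_ (trans (≗-cong (⊛-linearˡ (egf g) (suc n)) (θ-egf f)) (⊛-shiftˡ (egf (tail f)) (egf g) (suc n)))
                        (trans (≗-cong (⊛-linearʳ (egf f) (suc n)) (θ-egf g)) (⊛-shiftʳ (egf f) (egf (tail g)) (suc n))) ⟨
         (θ (egf f) ⊛ egf g) (suc n) + (egf f ⊛ θ (egf g)) (suc n)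
           ≡⟨ θ-⊛ (egf f) (egf g) (suc n) ⟨
         ι (suc n) * X ∎) ⟩
  ρ * (ι (suc n) * X)
    ≡⟨ solve 3 (λ ρ i x → ρ :* (i :* x) := (i :* ρ) :* x) refl ρ (ι (suc n)) X ⟩
  (ι (suc n) * ρ) * X
    ≡⟨ cong (_* X) (ι*recip (suc n)) ⟩
  1ℚ * X
    ≡⟨ ℚ.*-identityˡ X ⟩
  X ∎
  where
  b = bconv f g (suc n)
  ρ = recip (suc n)
  X = (egf f ⊛ egf g) (suc n)

-- Laplace expansion of determinants of series.

sign : ℕ → ℚ → ℚ
sign zero    x = x
sign (suc j) x = ℚ.- sign j x

sumS-eval : ∀ n (F : Fin n → Series) k → sumS F k ≡ ∑ (λ j → F j k)
sumS-eval zero    F k = refl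
sumS-eval (suc n) F k = cong (F zero k +_) (sumS-eval n (F ∘ suc) k)

1#-⊛ : ∀ f → 1# ⊛ f ≗ f
1#-⊛ f zero    = trans (ℚ.+-identityʳ (1ℚ * f 0)) (ℚ.*-identityˡ (f 0))
1#-⊛ f (suc k) = trans (cong₂ _+_ (ℚ.*-identityˡ (f (suc k))) (0-homo (⊛-linearˡ f k))) (ℚ.+-identityʳ (f (suc k)))

neg-⊛ : ∀ f g → (-ₛ f) ⊛ g ≗ -ₛ (f ⊛ g)
neg-⊛ f g k = -‿homo (⊛-linearˡ g k) f

sign-⊛ : ∀ j f k → (((-ₛ 1#) ^ j) ⊛ f) k ≡ sign j (f k)
sign-⊛ zero    f k = 1#-⊛ f k
sign-⊛ (suc j) f k = begin
  (((-ₛ 1#) ⊛ p) ⊛ f) k   ≡⟨ ≗-cong (⊛-linearˡ f k) (λ n → trans (neg-⊛ 1# p n) (cong ℚ.-_ (1#-⊛ p n))) ⟩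
  ((-ₛ p) ⊛ f) k          ≡⟨ neg-⊛ p f k ⟩
  ℚ.- (p ⊛ f) k           ≡⟨ cong ℚ.-_ (sign-⊛ j f k) ⟩
  ℚ.- sign j (f k)        ∎
  where p = (-ₛ 1#) ^ j

∑-sign-homo : ∀ {X : Set} {L : (X → ℚ) → ℚ} → Linear L → ∀ n (F : Fin n → X → ℚ) →
  L (λ x → ∑ (λ j → sign (toℕ j) (F j x))) ≡ ∑ (λ j → sign (toℕ j) (L (F j)))
∑-sign-homo {X} {L} l n F = go n (λ j → sign (toℕ j)) (λ j → sign-homo (toℕ j)) F
  where
  sign-homo : ∀ j f → L (λ x → sign j (f x)) ≡ sign j (L f)
  sign-homo zero    f = refl
  sign-homo (suc j) f = trans (-‿homo l (λ x → sign j (f x))) (cong ℚ.-_ (sign-homo j f))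

  go : ∀ n (h : Fin n → ℚ → ℚ) → (∀ j f → L (λ x → h j (f x)) ≡ h j (L f)) → (F : Fin n → X → ℚ) →
       L (λ x → ∑ (λ j → h j (F j x))) ≡ ∑ (λ j → h j (L (F j)))
  go zero    h eq F = 0-homo l
  go (suc n) h eq F = trans (+-homo l (λ x → h zero (F zero x)) (λ x → ∑ (λ j → h (suc j) (F (suc j) x))))
                            (cong₂ _+_ (eq zero (F zero)) (go n (h ∘ suc) (eq ∘ suc) (F ∘ suc)))

-- `punchIn j` enumerates the columns other than `j`, so the signed sum over `j` and the recursion
-- of `altSum` are the same expansion.
∑-altSum : ∀ n (κ : Fin (suc n) → ℕ) F →
  ∑ (λ j → sign (toℕ j) (F (κ j) (tabulate (κ ∘ punchIn j)))) ≡ altSum (tabulate κ) F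
∑-altSum zero    κ F = refl
∑-altSum (suc n) κ F = cong (F (κ zero) (tabulate (κ ∘ suc)) +_) (trans
  (-‿homo (∑-linear (suc n)) (λ j → sign (toℕ j) (F (κ (suc j)) (κ zero ∷ tabulate (κ ∘ suc ∘ punchIn j)))))
  (cong ℚ.-_ (∑-altSum n (κ ∘ suc) (λ y ys → F y (κ zero ∷ ys)))))

det-Laplace : ∀ n (M : Fin (suc n) → Fin (suc n) → Series) k →
  det (suc n) M k ≡ ∑ (λ j → sign (toℕ j) ((M zero j ⊛ det n (λ r s → M (suc r) (punchIn j s))) k))
det-Laplace n M k = trans
  (sumS-eval (suc n) (λ j → ((-ₛ 1#) ^ toℕ j) ⊛ P j) k)
  (≗-cong (∑-linear (suc n)) (λ j → sign-⊛ (toℕ j) (P j) k))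
  where
  P : Fin (suc n) → Series
  P j = M zero j ⊛ det n (λ r s → M (suc r) (punchIn j s))

-- The generating function of block sums as a determinant.

-- All entries of `fresh n` are 0, so coefficient `n` sums over all maps from `n` values to the
-- positions of `ys`.
blockSeries : (List ℕ → ℚ) → List ℕ → Series
blockSeries f ys n = blockSum f ys (fresh n)

-- The matrix entry 1/(a + y - i)! in row `i`, as a sequence in the size `a` of the block that
-- belongs to the column.
column : ℕ → ℕ → Series
column i y a = invFact (a ℕ.+ y) i

-- A further value goes either to the column removed in the Laplace expansion or to one of the
-- others; these cases are the two summands in the recursion of `bconv`.
blockSeries-factorialDet : ∀ n i ys k → blockSeries (factorialDet (suc n) i) ys k
       ≡ altSum ys (λ y zs → bconv (column i y) (blockSeries (factorialDet n (suc i)) zs) k)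
blockSeries-factorialDet n i ys zero    = refl
blockSeries-factorialDet n i ys (suc k) = begin
  deriv suc (λ zs → blockSeries (factorialDet (suc n) i) zs k) ys
    ≡⟨ ≗-cong (deriv-linear suc ys) (λ zs → blockSeries-factorialDet n i zs k) ⟩
  deriv suc (λ zs → altSum zs (B k)) ys
    ≡⟨ deriv-altSum suc (B k) ys ⟩
  altSum ys (λ y zs → B k (suc y) zs + deriv suc (B k y) zs)
    ≡⟨ altSum-cong ys (λ y zs _ → cong₂ _+_
         (bconv-congˡ (blockSeries D zs) k (λ a → cong (λ x → invFact x i) (ℕ.+-suc a y)))
         (sym (deriv-exchange (bconv-linearʳ (column i y) k) suc zs (λ b us → blockSeries D us b)))) ⟩
  altSum ys (B (suc k)) ∎
  where
  D = factorialDet n (suc i)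
  B : ℕ → ℕ → List ℕ → ℚ
  B k y zs = bconv (column i y) (blockSeries D zs) k

sum-punchIn : ∀ n (κ : Fin (suc n) → ℕ) j → κ j ℕ.+ sum (tabulate (κ ∘ punchIn j)) ≡ sum (tabulate κ)
sum-punchIn n       κ zero    = refl
sum-punchIn (suc n) κ (suc j) = trans
  (x∙yz≈y∙xz (κ (suc j)) (κ zero) (sum (tabulate (κ ∘ suc ∘ punchIn j))))
  (cong (κ zero ℕ.+_) (sum-punchIn n (κ ∘ suc) j))

-- Multiplying by powers of t, distributed over rows and columns, avoids the
-- negative exponents of t^(r - s) f(t²).
det-egf : ∀ n i (κ : Fin n → ℕ) (M : Fin n → Fin n → Series) →
  (∀ r s → shiftBy (i ℕ.+ toℕ r) (M r s) ≗ shiftBy (κ s) (square (egf (column (i ℕ.+ toℕ r) (κ s))))) →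
  shiftBy (sum (interval n i)) (det n M) ≗ shiftBy (sum (tabulate κ)) (square (egf (blockSeries (factorialDet n i) (tabulate κ))))
det-egf zero    i κ M eq zero          = refl
det-egf zero    i κ M eq (suc zero)    = refl
det-egf zero    i κ M eq (suc (suc k)) = sym (trans
  (≗-cong (square-linear k) (λ n → ℚ.*-zeroˡ (1/! suc n))) (0-homo (square-linear k)))
det-egf (suc n) i κ M eq k = begin
  shiftBy (i ℕ.+ R) (det (suc n) M) k
    ≡⟨ ≗-cong (shiftBy-linear (i ℕ.+ R) k) (det-Laplace n M) ⟩
  shiftBy (i ℕ.+ R) (λ x → ∑ (λ j → sign (toℕ j) ((M zero j ⊛ det n (minor j)) x))) k
    ≡⟨ ∑-sign-homo (shiftBy-linear (i ℕ.+ R) k) (suc n) (λ j → M zero j ⊛ det n (minor j)) ⟩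
  ∑ (λ j → sign (toℕ j) (shiftBy (i ℕ.+ R) (M zero j ⊛ det n (minor j)) k))
    ≡⟨ ≗-cong (∑-linear (suc n)) (λ j → cong (sign (toℕ j)) (term j)) ⟩
  ∑ (λ j → sign (toℕ j) (shiftBy K (square (egf (B j))) k))
    ≡⟨ ∑-sign-homo L (suc n) B ⟨
  shiftBy K (square (egf (λ x → ∑ (λ j → sign (toℕ j) (B j x))))) k
    ≡⟨ ≗-cong L (λ x → trans
         (∑-altSum n κ (λ y zs → bconv (column i y) (blockSeries (factorialDet n (suc i)) zs) x))
         (sym (blockSeries-factorialDet n i (tabulate κ) x))) ⟩
  shiftBy K (square (egf (blockSeries (factorialDet (suc n) i) (tabulate κ)))) k ∎
  where
  R = sum (interval n (suc i))
  K = sum (tabulate κ)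

  minor : Fin (suc n) → Fin n → Fin n → Series
  minor j r s = M (suc r) (punchIn j s)

  g : Fin (suc n) → Series
  g j = blockSeries (factorialDet n (suc i)) (tabulate (κ ∘ punchIn j))

  B : Fin (suc n) → Series
  B j = bconv (column i (κ j)) (g j)

  L : Linear (λ f → shiftBy K (square (egf f)) k)
  L = compose-linear (shiftBy-linear K k) λ x →
      compose-linear (square-linear x) λ n → scaleʳ-linear (evaluation n) (1/! n)

  first : ∀ j → shiftBy i (M zero j) ≗ shiftBy (κ j) (square (egf (column i (κ j))))
  first j = subst (λ x → shiftBy x (M zero j) ≗ shiftBy (κ j) (square (egf (column x (κ j)))))
                  (ℕ.+-identityʳ i) (eq zero j)

  rest : ∀ j → shiftBy R (det n (minor j)) ≗ shiftBy (sum (tabulate (κ ∘ punchIn j))) (square (egf (g j)))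
  rest j = det-egf n (suc i) (κ ∘ punchIn j) (minor j) λ r s →
    subst (λ x → shiftBy x (minor j r s) ≗ shiftBy (κ (punchIn j s)) (square (egf (column x (κ (punchIn j s))))))
          (ℕ.+-suc i (toℕ r)) (eq (suc r) (punchIn j s))

  term : ∀ j → shiftBy (i ℕ.+ R) (M zero j ⊛ det n (minor j)) k ≡ shiftBy K (square (egf (B j))) k
  term j = begin
    shiftBy (i ℕ.+ R) (M zero j ⊛ det n (minor j)) k
      ≡⟨ ⊛-shiftBy i R (M zero j) (det n (minor j)) k ⟨
    (shiftBy i (M zero j) ⊛ shiftBy R (det n (minor j))) k
      ≡⟨ ⊛-cong (first j) (rest j) k ⟩
    (shiftBy (κ j) (square c) ⊛ shiftBy K′ (square (egf (g j)))) k
      ≡⟨ ⊛-shiftBy (κ j) K′ (square c) (square (egf (g j))) k ⟩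
    shiftBy (κ j ℕ.+ K′) (square c ⊛ square (egf (g j))) k
      ≡⟨ cong (λ x → shiftBy x (square c ⊛ square (egf (g j))) k) (sum-punchIn n κ j) ⟩
    shiftBy K (square c ⊛ square (egf (g j))) k
      ≡⟨ ≗-cong (shiftBy-linear K k) (λ x → trans (square-⊛ c (egf (g j)) x)
           (≗-cong (square-linear x) (sym ∘ egf-bconv (column i (κ j)) (g j)))) ⟩
    shiftBy K (square (egf (B j))) k ∎
    where
    c = egf (column i (κ j))
    K′ = sum (tabulate (κ ∘ punchIn j))

-- The series I and the entries of the determinant.

shiftBy-< : ∀ {d k} f → k < d → shiftBy d f k ≡ 0ℚ
shiftBy-< {suc d} {zero}  f _         = refl
shiftBy-< {suc d} {suc k} f (s≤s k<d) = shiftBy-< f k<d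

-- The terms with n ≥ N have exponent d + 2n ≥ d + N > k, so `N` terms suffice for coefficient `k`.
σ-monomial : ∀ N d (c : Series) k → k < d ℕ.+ N →
  σ N (λ n → monomial (c n) (d ℕ.+ double n) k) ≡ shiftBy d (square c) k
σ-monomial N       (suc d) c zero          _               = 0-homo (σ-linear N)
σ-monomial N       (suc d) c (suc k)       (s≤s k<)        = σ-monomial N d c k k<
σ-monomial (suc N) zero    c zero          _               =
  trans (cong (c 0 +_) (0-homo (σ-linear N))) (ℚ.+-identityʳ (c 0))
σ-monomial (suc N) zero    c (suc zero)    _               =
  trans (cong (0ℚ +_) (0-homo (σ-linear N))) (ℚ.+-identityʳ 0ℚ)
σ-monomial (suc N) zero    c (suc (suc k)) (s≤s k<)        = trans
  (ℚ.+-identityˡ (σ N (λ n → monomial (c (suc n)) (double n) k)))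
  (σ-monomial N zero (c ∘ suc) k (ℕ.<-trans (ℕ.n<1+n k) k<))

σ-skip : ∀ d N {f} → (∀ n → n < d → f n ≡ 0ℚ) → σ (d ℕ.+ N) f ≡ σ N (λ n → f (d ℕ.+ n))
σ-skip zero    N     z = refl
σ-skip (suc d) N {f} z = begin
  f 0 + σ (d ℕ.+ N) (f ∘ suc)  ≡⟨ cong₂ _+_ (z 0 (s≤s z≤n)) (σ-skip d N λ n n<d → z (suc n) (s≤s n<d)) ⟩
  0ℚ + σ N (λ n → f (suc d ℕ.+ n)) ≡⟨ ℚ.+-identityˡ (σ N (λ n → f (suc d ℕ.+ n))) ⟩
  σ N (λ n → f (suc d ℕ.+ n))  ∎

-- The coefficients b for which both I_d and I_(-d) are t^d b(t²).
bessel : ℕ → Series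
bessel d n = 1/! n * 1/! (d ℕ.+ n)

I-pos : ∀ d → I (ℤ.+ d) ≗ shiftBy d (square (bessel d))
I-pos d k = trans
  (σ-cong (suc k) λ n _ → cong₂ (λ c e → monomial c e k)
    (trans (1/!-* n (n ℕ.+ d)) (cong (λ x → 1/! n * 1/! x) (ℕ.+-comm n d)))
    (trans (trans (sym (ℕ.+-assoc n n d)) (ℕ.+-comm (n ℕ.+ n) d)) (cong (d ℕ.+_) (sym (double≡+ n)))))
  (σ-monomial (suc k) d (bessel d) k (ℕ.m≤n+m (suc k) d))

besselTerm-< : ∀ {n d} k → n < suc d → besselTerm -[1+ d ] n k ≡ 0ℚ
besselTerm-< k n≤d rewrite ℤ.⊖-< n≤d | ℕ.+-∸-assoc 1 (ℕ.s≤s⁻¹ n≤d) = refl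

-- The terms with n < d are absent, and replacing n by d + n turns the others into the terms of I_d.
I-neg : ∀ d → I (ℤ.- (ℤ.+ d)) ≗ shiftBy d (square (bessel d))
I-neg zero        = I-pos zero
I-neg (suc d) k with ℕ.≤-<-connex (suc d) k
... | inj₂ k≤d = trans (trans (σ-cong (suc k) λ n n≤k → besselTerm-< k (ℕ.<-≤-trans n≤k k≤d)) (0-homo (σ-linear (suc k))))
                        (sym (shiftBy-< (square (bessel (suc d))) k≤d))
... | inj₁ d<k = begin
  σ (suc k) f                                  ≡⟨ cong (λ x → σ x f) (ℕ.m+[n∸m]≡n (ℕ.m≤n⇒m≤1+n d<k)) ⟨
  σ (suc d ℕ.+ N) f                            ≡⟨ σ-skip (suc d) N (λ n → besselTerm-< k) ⟩
  σ N (λ n → f (suc d ℕ.+ n))                  ≡⟨ σ-cong N (λ n _ → large n) ⟩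
  σ N (λ n → monomial (bessel (suc d) n) (suc d ℕ.+ double n) k)
    ≡⟨ σ-monomial N (suc d) (bessel (suc d)) k (subst (k <_) (sym (ℕ.m+[n∸m]≡n (ℕ.m≤n⇒m≤1+n d<k))) ℕ.≤-refl) ⟩
  shiftBy (suc d) (square (bessel (suc d))) k  ∎
  where
  -- The number of terms that remain of the truncated sum after the `suc d` vanishing ones.
  N = suc k ∸ suc d
  f : ℕ → ℚ
  f n = besselTerm -[1+ d ] n k
  large : ∀ n → f (suc d ℕ.+ n) ≡ monomial (bessel (suc d) n) (suc d ℕ.+ double n) k
  large n rewrite ℤ.⊖-≥ (ℕ.m≤m+n (suc d) n) | ℕ.m+n∸m≡n d n = cong₂ (λ c e → monomial c e k)
    (trans (1/!-* (suc d ℕ.+ n) n) (ℚ.*-comm (1/! (suc d ℕ.+ n)) (1/! n)))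
    (trans (ℕ.+-assoc (suc d) n n) (cong (suc d ℕ.+_) (sym (double≡+ n))))

-- The factor 1/(a - d)! vanishes for a < d, as do the first `d` coefficients of a shift; beyond
-- that, a = d + n.
invFact-shift : ∀ d (w : ℕ → ℚ) a → invFact a d * w a ≡ shiftBy d (λ n → 1/! n * w (d ℕ.+ n)) a
invFact-shift zero    w a       = refl
invFact-shift (suc d) w zero    = ℚ.*-zeroˡ (w 0)
invFact-shift (suc d) w (suc a) = invFact-shift d (w ∘ suc) a

invFact-+ : ∀ s a i → invFact (s ℕ.+ a) (s ℕ.+ i) ≡ invFact a i
invFact-+ zero    a i = refl
invFact-+ (suc s) a i = invFact-+ s a i

-- With d = |r - s|, both sides are a power of t times `square (bessel d)`. The exponents agree: r +
-- d = s + 2d if s ≤ r, and r + d = s if r ≤ s.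
shiftBy-I : ∀ r s → shiftBy r (I (ℤ.+ r ℤ.- ℤ.+ s)) ≗ shiftBy s (square (egf (column r s)))
shiftBy-I r s k with ℕ.≤-total s r
... | inj₁ s≤r = begin
  shiftBy r (I (ℤ.+ r ℤ.- ℤ.+ s)) k
    ≡⟨ cong (λ z → shiftBy r (I z) k) (trans (ℤ.[+m]-[+n]≡m⊖n r s) (ℤ.⊖-≥ s≤r)) ⟩
  shiftBy r (I (ℤ.+ d)) k
    ≡⟨ ≗-cong (shiftBy-linear r k) (I-pos d) ⟩
  shiftBy r (shiftBy d b) k
    ≡⟨ cong (λ f → f k) (shiftBy-+ r d b) ⟩
  shiftBy (r ℕ.+ d) b k
    ≡⟨ cong (λ x → shiftBy x b k) (begin
         r ℕ.+ d           ≡⟨ cong (ℕ._+ d) (ℕ.m+[n∸m]≡n s≤r) ⟨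
         s ℕ.+ d ℕ.+ d     ≡⟨ ℕ.+-assoc s d d ⟩
         s ℕ.+ (d ℕ.+ d)   ≡⟨ cong (s ℕ.+_) (double≡+ d) ⟨
         s ℕ.+ double d    ∎) ⟩
  shiftBy (s ℕ.+ double d) b k
    ≡⟨ cong (λ f → f k) (shiftBy-+ s (double d) b) ⟨
  shiftBy s (shiftBy (double d) b) k
    ≡⟨ ≗-cong (shiftBy-linear s k) (square-shiftBy d (bessel d)) ⟨
  shiftBy s (square (shiftBy d (bessel d))) k
    ≡⟨ ≗-cong (shiftBy-linear s k) (λ x → ≗-cong (square-linear x) λ a → trans (sym (invFact-shift d 1/!_ a))
         (cong (_* 1/! a) (trans (sym (invFact-+ s a d)) (cong₂ invFact (ℕ.+-comm s a) (ℕ.m+[n∸m]≡n s≤r))))) ⟩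
  shiftBy s (square (egf (column r s))) k ∎
  where
  d = r ∸ s
  b = square (bessel d)
... | inj₂ r≤s = begin
  shiftBy r (I (ℤ.+ r ℤ.- ℤ.+ s)) k
    ≡⟨ cong (λ z → shiftBy r (I z) k) (trans (ℤ.[+m]-[+n]≡m⊖n r s) (ℤ.⊖-≤ r≤s)) ⟩
  shiftBy r (I (ℤ.- (ℤ.+ d))) k
    ≡⟨ ≗-cong (shiftBy-linear r k) (I-neg d) ⟩
  shiftBy r (shiftBy d b) k
    ≡⟨ cong (λ f → f k) (shiftBy-+ r d b) ⟩
  shiftBy (r ℕ.+ d) b k
    ≡⟨ cong (λ x → shiftBy x b k) (ℕ.m+[n∸m]≡n r≤s) ⟩
  shiftBy s b k
    ≡⟨ ≗-cong (shiftBy-linear s k) (λ x → ≗-cong (square-linear x) λ a → trans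
         (ℚ.*-comm (1/! a) (1/! (d ℕ.+ a)))
         (cong (_* 1/! a) (trans (sym (invFact-+ r (d ℕ.+ a) 0)) (cong₂ invFact (reorder a) (ℕ.+-identityʳ r))))) ⟩
  shiftBy s (square (egf (column r s))) k ∎
  where
  d = s ∸ r
  b = square (bessel d)
  reorder : ∀ a → r ℕ.+ (d ℕ.+ a) ≡ a ℕ.+ s
  reorder a = trans (sym (ℕ.+-assoc r d a)) (trans (cong (ℕ._+ a) (ℕ.m+[n∸m]≡n r≤s)) (ℕ.+-comm s a))

-- Comparison of the two sides.

tabulate-interval : ∀ n i → tabulate {n = n} (λ s → i ℕ.+ toℕ s) ≡ interval n i
tabulate-interval zero    i = refl
tabulate-interval (suc n) i = cong₂ _∷_ (ℕ.+-identityʳ i)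
  (trans (tabulate-cong (λ s → ℕ.+-suc i (toℕ s))) (tabulate-interval n (suc i)))

-- Its coefficient `n` is the number of permutations of length n in 𝔖⁽ᵐ⁾ divided by n!². Both sides
-- of the theorem are reduced to this series at t².
countSeries : ℕ → Series
countSeries m = egf (blockSeries (alternant m) (staircase m))

-- Rows and columns are both numbered 1, ..., m, so the two powers of t in `det-egf` coincide and
-- cancel.
det-I : ∀ m → det m (λ i j → I (ℤ.+ toℕ i ℤ.- ℤ.+ toℕ j)) ≗ square (countSeries m)
det-I m = shiftBy-injective (sum (interval m 1)) λ k → trans
  (det-egf m 1 (suc ∘ toℕ) (λ i j → I (ℤ.+ toℕ i ℤ.- ℤ.+ toℕ j)) entry′ k)
  (cong (λ ys → shiftBy (sum ys) (square (egf (blockSeries (alternant m) ys))) k) (tabulate-interval m 1))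
  where
  entry′ : ∀ (r s : Fin m) → shiftBy (suc (toℕ r)) (I (ℤ.+ toℕ r ℤ.- ℤ.+ toℕ s))
         ≗ shiftBy (suc (toℕ s)) (square (egf (column (suc (toℕ r)) (suc (toℕ s)))))
  entry′ r s k = trans
    -- The indices start at 0 in the theorem and at 1 in `staircase`; only their difference enters.
    (cong (λ z → shiftBy (suc (toℕ r)) (I z) k) (trans (ℤ.[+m]-[+n]≡m⊖n (toℕ r) (toℕ s)) (sym (ℤ.[1+m]⊖[1+n]≡m⊖n (toℕ r) (toℕ s)))))
    (shiftBy-I (suc (toℕ r)) (suc (toℕ s)) k)

monomial-* : ∀ c x e k → c * monomial x e k ≡ monomial (c * x) e k
monomial-* c x e k with does (k ℕ.≟ e)
... | true  = refl
... | false = ℚ.*-zeroʳ c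

lhs-countSeries : ∀ m → lhs m ≗ square (countSeries m)
lhs-countSeries m k = trans (σ-cong (suc k) (λ n _ → term n)) (σ-monomial (suc k) 0 (countSeries m) k ℕ.≤-refl)
  where
  term : ∀ n → lhsTerm m n k ≡ monomial (countSeries m n) (double n) k
  term n = begin
    lhsTerm m n k
      ≡⟨ lhsTerm-blockSum m n k ⟩
    (ι (n !) * g) * monomial 1/[ n !* n !] (2 ℕ.* n) k
      ≡⟨ monomial-* (ι (n !) * g) 1/[ n !* n !] (2 ℕ.* n) k ⟩
    monomial ((ι (n !) * g) * 1/[ n !* n !]) (2 ℕ.* n) k
      ≡⟨ cong₂ (λ c e → monomial c e k) (begin
           (ι (n !) * g) * 1/[ n !* n !]
             ≡⟨ cong ((ι (n !) * g) *_) (1/!-* n n) ⟩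
           (ι (n !) * g) * (1/! n * 1/! n)
             ≡⟨ solve 3 (λ i g w → (i :* g) :* (w :* w) := (i :* w) :* (g :* w)) refl (ι (n !)) g (1/! n) ⟩
           (ι (n !) * 1/! n) * (g * 1/! n)
             ≡⟨ cong (_* (g * 1/! n)) (ι*recip (n !) {{n ℕ.!≢0}}) ⟩
           1ℚ * (g * 1/! n)
             ≡⟨ ℚ.*-identityˡ (g * 1/! n) ⟩
           countSeries m n ∎)
         (trans (cong (n ℕ.+_) (ℕ.+-identityʳ n)) (sym (double≡+ n))) ⟩
    monomial (countSeries m n) (double n) k ∎
    where g = blockSeries (alternant m) (staircase m) n

open import Data.Integer.Base using (+_; _-_)

theorem1 : (m : ℕ) → 1 ≤ m →
    lhs m ≈ₛ det m (λ i j → I (+ toℕ i - + toℕ j))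
theorem1 m _ k = trans (lhs-countSeries m k) (sym (det-I m k))
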